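{- Let $b_n$ be the number of permutations of $[n]$ all of whose peaks and valleys are even, and let $c_n$ be the number of permutations of $[n]$ all of whose peaks and valleys are odd ($b_0=c_0=1$). Then $$\sum_{n\ge0}b_n\frac{x^n}{n!}=(1+x)\frac{2+2\cosh(\sqrt2 x)+\sqrt2 x\sinh(\sqrt2 x)}{2+2\cosh(\sqrt2 x)-\sqrt2 x\sinh(\sqrt2 x)}$$ and $$\sum_{n\ge0}c_n\frac{x^n}{n!}=\frac{2+2\cosh(\sqrt2 x)+\sqrt2(2+x)\sinh(\sqrt2 x)}{2+2\cosh(\sqrt2 x)-\sqrt2 x\sinh(\sqrt2 x)}.$$
   Context: For a permutation $\pi=\pi_1\cdots\pi_n$, an index $i$ (with $2\le i\le n-1$) is a peak if $\pi_{i-1}<\pi_i>\pi_{i+1}$ and a valley if $\pi_{i-1}>\pi_i<\pi_{i+1}$. The conditions are vacuous for permutations with no peaks or valleys. -}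

module Defs where

open import Data.Bool using (Bool; true; false; _∧_; _∨_; if_then_else_)
open import Data.Nat as ℕ using (ℕ; zero; suc; _∸_; _<ᵇ_; _!)
open import Data.Nat.Properties using (_!≢0)
open import Data.List using (List; []; _∷_; map; concatMap; length; filterᵇ; upTo; foldr)
open import Data.Integer using (+_)
open import Data.Rational using (ℚ; 0ℚ; 1ℚ; _+_; _*_; _-_; _/_)

-- Permutations of [n] = {1,…,n}, as lists (one-line notation π₁⋯πₙ)

insertions : ℕ → List ℕ → List (List ℕ)
insertions x []       = (x ∷ []) ∷ []
insertions x (y ∷ ys) = (x ∷ y ∷ ys) ∷ map (y ∷_) (insertions x ys)

-- all permutations of a list (of distinct elements), each exactly once
perms : List ℕ → List (List ℕ)
perms []       = [] ∷ []
perms (x ∷ xs) = concatMap (insertions x) (perms xs)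

range : ℕ → List ℕ
range n = map suc (upTo n)

Perms : ℕ → List (List ℕ)
Perms n = perms (range n)

isEven : ℕ → Bool
isEven zero          = true
isEven (suc zero)    = false
isEven (suc (suc n)) = isEven n

isOdd : ℕ → Bool
isOdd n = if isEven n then false else true

isPeak : ℕ → ℕ → ℕ → Bool
isPeak a b c = (a <ᵇ b) ∧ (c <ᵇ b)

isValley : ℕ → ℕ → ℕ → Bool
isValley a b c = (b <ᵇ a) ∧ (b <ᵇ c)

-- allPV P i π : every peak or valley index of π satisfies P, where the
-- second entry of the list π is at (1-based) index i.
allPV' : (ℕ → Bool) → ℕ → List ℕ → Bool
allPV' P i (a ∷ b ∷ c ∷ rest) =
  (if isPeak a b c ∨ isValley a b c then P i else true) ∧ allPV' P (suc i) (b ∷ c ∷ rest)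
allPV' P i _ = true

-- all peaks and valleys of π (positions 1-based) satisfy P
allPV : (ℕ → Bool) → List ℕ → Bool
allPV P π = allPV' P 2 π

b : ℕ → ℕ
b n = length (filterᵇ (allPV isEven) (Perms n))

c : ℕ → ℕ
c n = length (filterᵇ (allPV isOdd) (Perms n))

-- Formal power series over ℚ: a series is its coefficient sequence

Series : Set
Series = ℕ → ℚ

const : ℚ → Series
const q zero    = q
const q (suc n) = 0ℚ

X : Series
X (suc zero) = 1ℚ
X _          = 0ℚ

_⊕_ : Series → Series → Series
(f ⊕ g) n = f n + g n

_⊖_ : Series → Series → Series
(f ⊖ g) n = f n - g n

_⊛_ : Series → Series → Series
(f ⊛ g) n = foldr _+_ 0ℚ (map (λ k → f k * g (n ∸ k)) (upTo (suc n)))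

infixl 6 _⊕_ _⊖_
infixl 7 _⊛_

inv! : ℕ → ℚ
inv! n = (+ 1) / (n !)
  where instance _ = n !≢0

egf : (ℕ → ℕ) → Series
egf a n = (+ a n) / (n !)
  where instance _ = n !≢0

-- cosh(√2 x) = Σ_k (√2)^{2k} x^{2k}/(2k)! = Σ_k 2^k x^{2k}/(2k)!
coshR2 : Series
coshR2 n = if isEven n then ((+ (2 ℕ.^ (n ℕ./ 2))) / 1) * inv! n else 0ℚ

-- √2 sinh(√2 x) = Σ_k (√2)^{2k+2} x^{2k+1}/(2k+1)! = Σ_k 2^{k+1} x^{2k+1}/(2k+1)!
r2sinhR2 : Series
r2sinhR2 n = if isOdd n then ((+ (2 ℕ.^ suc (n ℕ./ 2))) / 1) * inv! n else 0ℚ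

two : Series
two = const ((+ 2) / 1)

Den : Series
Den = two ⊕ two ⊛ coshR2 ⊖ X ⊛ r2sinhR2

NumB : Series
NumB = two ⊕ two ⊛ coshR2 ⊕ X ⊛ r2sinhR2

NumC : Series
NumC = two ⊕ two ⊛ coshR2 ⊕ (two ⊕ X) ⊛ r2sinhR2

onePlusX : Series
onePlusX = const 1ℚ ⊕ X

{-# OPTIONS --safe #-}
module Submission where

open import Defs
open import Algebra.Bundles using (CommutativeRing)
import Algebra.Construct.Pointwise as Pointwise
import Algebra.Solver.Ring
open import Algebra.Solver.Ring.AlmostCommutativeRing
  using (fromCommutativeRing; _-Raw-AlmostCommutative⟶_)
open import Data.Bool using (Bool; true; false; if_then_else_; T; not; _∨_)
open import Data.Fin using (Fin)
open import Data.Fin.Patterns using (0F; 1F; 2F)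
open import Data.Integer as ℤ using (ℤ; +_; 0ℤ; 1ℤ; -1ℤ)
import Data.Integer.Properties as ℤₚ
import Data.Integer.Solver as ℤSolver
open import Data.List using (List; []; _∷_; _++_; map; concatMap; foldr; length; filterᵇ; applyUpTo)
import Data.List.Properties as Listₚ
open import Data.List.Relation.Binary.Sublist.Propositional using (_⊆_; []; _∷_; _∷ʳ_)
open import Data.List.Relation.Binary.Sublist.Propositional.Properties using (length-mono-≤; All-resp-⊆)
open import Data.List.Relation.Unary.All as All using (All; []; _∷_)
import Data.List.Relation.Unary.All.Properties as Allₚ
open import Data.List.Relation.Unary.AllPairs using (AllPairs; []; _∷_)
import Data.List.Relation.Unary.AllPairs.Properties as AllPairsₚ
open import Data.Maybe using (Maybe; just; nothing)
open import Data.Nat as ℕ using (ℕ; zero; suc; z≤n; s≤s; _<ᵇ_; _!)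
import Data.Nat.DivMod as ℕDivMod
import Data.Nat.Properties as ℕₚ
open import Data.Product using (_×_; _,_)
open import Data.Rational as ℚ using (ℚ; 0ℚ; 1ℚ; fromℚᵘ; toℚᵘ)
import Data.Rational.Properties as ℚₚ
import Data.Rational.Solver as ℚSolver
open import Data.Rational.Unnormalised as ℚᵘ using (mkℚᵘ; *≡*)
import Data.Rational.Unnormalised.Properties as ℚᵘₚ
open import Data.Unit using (⊤)
open import Function using (_∘_)
open import Level using (0ℓ)
open import Relation.Binary.PropositionalEquality
open import Relation.Nullary using (yes; no; contradiction)

-- Removing the minimum x from a permutation u x v leaves two independent
-- permutations u and v, each adjacent to a smaller entry.  Peaks and valleys are
-- permitted at every second position, so if x sits at a permitted position,
-- the conditions on u and v decouple; otherwise x must be the first or last entry.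
-- For the nine combinations of boundary conditions this gives a closed
-- system of differential equations for the exponential generating functions.
-- With s = √2 sinh(√2 x), c = cosh(√2 x), Δ = 2 + 2c − xs it is solved by
-- F = 2s/Δ, R = (2 + 2c)/Δ, M = −Δ′/Δ, E = 1 + xF, H = xR and O = xE; these
-- closed forms are verified through the uniqueness of power series solutions.

-- The closed forms come from a linearisation. The equation M′ = M² + 2R - 2 is of Riccati type; M =
-- -Δ′/Δ turns it into Δ″ = 2Δ - 2ΔR, and R′ = F + RM into (ΔR)′ = ΔF. With ΔF = 2s and ΔR = 2 + 2c
-- both hold identically, and F′ = R² reduces to s² = 2c² - 2. The obstacle is division: the counts
-- are integers and Δ has constant term 4, so it has no inverse among integer sequences. Every
-- closed form is therefore multiplied out, and residuals such as ΔF - 2s are shown to vanish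
-- because they satisfy homogeneous linear equations with zero initial values. The equation F′ = R²
-- costs a second factor Δ, which is cancelled coefficient by coefficient.

-- A sequence α stands for its exponential generating function Σ αₙ xⁿ/n!:
-- differentiation is the shift, and the product is determined by Leibniz's rule.
Sequence : Set
Sequence = ℕ → ℤ

D : Sequence → Sequence
D α = α ∘ suc

constant : ℤ → Sequence
constant z zero    = z
constant z (suc n) = 0ℤ

-- The commutative ring of integer sequences under the Leibniz product

infixl 6 _+ˢ_
infixl 7 _*ˢ_

_+ˢ_ : Sequence → Sequence → Sequence
(α +ˢ β) n = α n ℤ.+ β n

-ˢ_ : Sequence → Sequence
(-ˢ α) n = ℤ.- α n

_*ˢ_ : Sequence → Sequence → Sequence
(α *ˢ β) zero    = α 0 ℤ.* β 0
(α *ˢ β) (suc n) = (D α *ˢ β) n ℤ.+ (α *ˢ D β) n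

-- The bound serves the later inductions, where two sequences are known to agree only up to the
-- current index.
*ˢ-cong-≤ : ∀ n {α α′ β β′} → (∀ k → k ℕ.≤ n → α k ≡ α′ k) → (∀ k → k ℕ.≤ n → β k ≡ β′ k) →
            (α *ˢ β) n ≡ (α′ *ˢ β′) n
*ˢ-cong-≤ zero    p q = cong₂ ℤ._*_ (p 0 z≤n) (q 0 z≤n)
*ˢ-cong-≤ (suc n) p q = cong₂ ℤ._+_
  (*ˢ-cong-≤ n (λ k k≤n → p (suc k) (s≤s k≤n)) (λ k k≤n → q k (ℕₚ.m≤n⇒m≤1+n k≤n)))
  (*ˢ-cong-≤ n (λ k k≤n → p k (ℕₚ.m≤n⇒m≤1+n k≤n)) (λ k k≤n → q (suc k) (s≤s k≤n)))

*ˢ-cong : ∀ {α α′ β β′} → α ≗ α′ → β ≗ β′ → α *ˢ β ≗ α′ *ˢ β′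
*ˢ-cong p q n = *ˢ-cong-≤ n (λ k _ → p k) (λ k _ → q k)

*ˢ-comm : ∀ α β → α *ˢ β ≗ β *ˢ α
*ˢ-comm α β zero    = ℤₚ.*-comm (α 0) (β 0)
*ˢ-comm α β (suc n) = trans (cong₂ ℤ._+_ (*ˢ-comm (D α) β n) (*ˢ-comm α (D β) n)) (ℤₚ.+-comm ((β *ˢ D α) n) _)

*ˢ-distribˡ : ∀ α β γ → α *ˢ (β +ˢ γ) ≗ α *ˢ β +ˢ α *ˢ γ
*ˢ-distribˡ α β γ zero    = ℤₚ.*-distribˡ-+ (α 0) (β 0) (γ 0)
*ˢ-distribˡ α β γ (suc n) = trans
  (cong₂ ℤ._+_ (*ˢ-distribˡ (D α) β γ n) (*ˢ-distribˡ α (D β) (D γ) n))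
  (solve 4 (λ a b c d → (a :+ b) :+ (c :+ d) := (a :+ c) :+ (b :+ d)) refl
    ((D α *ˢ β) n) ((D α *ˢ γ) n) ((α *ˢ D β) n) ((α *ˢ D γ) n))
  where open ℤSolver.+-*-Solver

*ˢ-distribʳ : ∀ α β γ → (β +ˢ γ) *ˢ α ≗ β *ˢ α +ˢ γ *ˢ α
*ˢ-distribʳ α β γ n = trans (*ˢ-comm (β +ˢ γ) α n) (trans (*ˢ-distribˡ α β γ n)
  (cong₂ ℤ._+_ (*ˢ-comm α β n) (*ˢ-comm α γ n)))

-- Under `D` both bracketings expand to the same three triple products, one for each differentiated
-- factor.
*ˢ-assoc : ∀ α β γ → (α *ˢ β) *ˢ γ ≗ α *ˢ (β *ˢ γ)
*ˢ-assoc α β γ zero    = ℤₚ.*-assoc (α 0) (β 0) (γ 0)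
*ˢ-assoc α β γ (suc n) = begin
  ((D α *ˢ β +ˢ α *ˢ D β) *ˢ γ) n ℤ.+ ((α *ˢ β) *ˢ D γ) n
    ≡⟨ cong (λ z → z ℤ.+ ((α *ˢ β) *ˢ D γ) n) (*ˢ-distribʳ γ (D α *ˢ β) (α *ˢ D β) n) ⟩
  (((D α *ˢ β) *ˢ γ) n ℤ.+ ((α *ˢ D β) *ˢ γ) n) ℤ.+ ((α *ˢ β) *ˢ D γ) n
    ≡⟨ cong₂ ℤ._+_ (cong₂ ℤ._+_ (*ˢ-assoc (D α) β γ n) (*ˢ-assoc α (D β) γ n)) (*ˢ-assoc α β (D γ) n) ⟩
  ((D α *ˢ (β *ˢ γ)) n ℤ.+ (α *ˢ (D β *ˢ γ)) n) ℤ.+ (α *ˢ (β *ˢ D γ)) n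
    ≡⟨ ℤₚ.+-assoc ((D α *ˢ (β *ˢ γ)) n) _ _ ⟩
  (D α *ˢ (β *ˢ γ)) n ℤ.+ ((α *ˢ (D β *ˢ γ)) n ℤ.+ (α *ˢ (β *ˢ D γ)) n)
    ≡⟨ cong (λ z → (D α *ˢ (β *ˢ γ)) n ℤ.+ z) (*ˢ-distribˡ α (D β *ˢ γ) (β *ˢ D γ) n) ⟨
  (D α *ˢ (β *ˢ γ)) n ℤ.+ (α *ˢ (D β *ˢ γ +ˢ β *ˢ D γ)) n ∎
  where open ≡-Reasoning

*ˢ-zeroˡ : ∀ α → (λ _ → 0ℤ) *ˢ α ≗ (λ _ → 0ℤ)
*ˢ-zeroˡ α zero    = refl
*ˢ-zeroˡ α (suc n) = cong₂ ℤ._+_ (*ˢ-zeroˡ α n) (*ˢ-zeroˡ (D α) n)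

*ˢ-identityˡ : ∀ α → constant 1ℤ *ˢ α ≗ α
*ˢ-identityˡ α zero    = ℤₚ.*-identityˡ (α 0)
*ˢ-identityˡ α (suc n) = trans (cong₂ ℤ._+_ (*ˢ-zeroˡ α n) (*ˢ-identityˡ (D α) n)) (ℤₚ.+-identityˡ _)

sequenceRing : CommutativeRing 0ℓ 0ℓ
sequenceRing = record
  { Carrier = Sequence
  ; _≈_ = _≗_
  ; _+_ = _+ˢ_
  ; _*_ = _*ˢ_
  ; -_  = -ˢ_
  ; 0#  = λ _ → 0ℤ
  ; 1#  = constant 1ℤ
  ; isCommutativeRing = record
    { isRing = record
      { +-isAbelianGroup = Pointwise.isAbelianGroup ℕ ℤₚ.+-0-isAbelianGroup
      ; *-cong = *ˢ-cong
      ; *-assoc = *ˢ-assoc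
      ; *-identity = *ˢ-identityˡ , λ α n → trans (*ˢ-comm α (constant 1ℤ) n) (*ˢ-identityˡ α n)
      ; distrib = *ˢ-distribˡ , *ˢ-distribʳ
      }
    ; *-comm = *ˢ-comm
    }
  }

constant-homo-+ : ∀ y z → constant (y ℤ.+ z) ≗ constant y +ˢ constant z
constant-homo-+ y z zero    = refl
constant-homo-+ y z (suc n) = refl

constant-homo-* : ∀ y z → constant (y ℤ.* z) ≗ constant y *ˢ constant z
constant-homo-* y z zero    = refl
constant-homo-* y z (suc n) = sym (cong₂ ℤ._+_ (*ˢ-zeroˡ (constant z) n)
  (trans (*ˢ-comm (constant y) (λ _ → 0ℤ) n) (*ˢ-zeroˡ (constant y) n)))

constant-homo-neg : ∀ z → constant (ℤ.- z) ≗ -ˢ constant z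
constant-homo-neg z zero    = refl
constant-homo-neg z (suc n) = refl

constant-homo-0 : constant 0ℤ ≗ λ _ → 0ℤ
constant-homo-0 zero    = refl
constant-homo-0 (suc n) = refl

constantMorphism : CommutativeRing.rawRing ℤₚ.+-*-commutativeRing -Raw-AlmostCommutative⟶ fromCommutativeRing sequenceRing
constantMorphism = record
  { ⟦_⟧    = constant
  ; +-homo = constant-homo-+
  ; *-homo = constant-homo-*
  ; -‿homo = constant-homo-neg
  ; 0-homo = constant-homo-0
  ; 1-homo = λ _ → refl
  }

constant≟ : ∀ y z → Maybe (constant y ≗ constant z)
constant≟ y z with y ℤ.≟ z
... | yes refl = just λ _ → refl
... | no  _    = nothing

module SequenceSolver = Algebra.Solver.Ring
  (CommutativeRing.rawRing ℤₚ.+-*-commutativeRing) (fromCommutativeRing sequenceRing) constantMorphism constant≟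

-- Transfer to rational power series

fromℚᵘ-homo-+ : ∀ p q → fromℚᵘ (p ℚᵘ.+ q) ≡ fromℚᵘ p ℚ.+ fromℚᵘ q
fromℚᵘ-homo-+ p q = ℚₚ.toℚᵘ-injective (begin
  toℚᵘ (fromℚᵘ (p ℚᵘ.+ q))              ≈⟨ ℚₚ.toℚᵘ-fromℚᵘ (p ℚᵘ.+ q) ⟩
  p ℚᵘ.+ q                              ≈⟨ ℚᵘₚ.+-cong (ℚₚ.toℚᵘ-fromℚᵘ p) (ℚₚ.toℚᵘ-fromℚᵘ q) ⟨
  toℚᵘ (fromℚᵘ p) ℚᵘ.+ toℚᵘ (fromℚᵘ q)  ≈⟨ ℚₚ.toℚᵘ-homo-+ (fromℚᵘ p) (fromℚᵘ q) ⟨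
  toℚᵘ (fromℚᵘ p ℚ.+ fromℚᵘ q)          ∎)
  where open import Relation.Binary.Reasoning.Setoid ℚᵘₚ.≃-setoid

fromℚᵘ-homo-* : ∀ p q → fromℚᵘ (p ℚᵘ.* q) ≡ fromℚᵘ p ℚ.* fromℚᵘ q
fromℚᵘ-homo-* p q = ℚₚ.toℚᵘ-injective (begin
  toℚᵘ (fromℚᵘ (p ℚᵘ.* q))              ≈⟨ ℚₚ.toℚᵘ-fromℚᵘ (p ℚᵘ.* q) ⟩
  p ℚᵘ.* q                              ≈⟨ ℚᵘₚ.*-cong (ℚₚ.toℚᵘ-fromℚᵘ p) (ℚₚ.toℚᵘ-fromℚᵘ q) ⟨
  toℚᵘ (fromℚᵘ p) ℚᵘ.* toℚᵘ (fromℚᵘ q)  ≈⟨ ℚₚ.toℚᵘ-homo-* (fromℚᵘ p) (fromℚᵘ q) ⟨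
  toℚᵘ (fromℚᵘ p ℚ.* fromℚᵘ q)          ∎)
  where open import Relation.Binary.Reasoning.Setoid ℚᵘₚ.≃-setoid

ι : ℤ → ℚ
ι z = z ℚ./ 1

ι-+ : ∀ y z → ι (y ℤ.+ z) ≡ ι y ℚ.+ ι z
ι-+ y z = trans
  (ℚₚ.fromℚᵘ-cong {mkℚᵘ (y ℤ.+ z) 0} {mkℚᵘ y 0 ℚᵘ.+ mkℚᵘ z 0}
    (*≡* (solve 2 (λ y z → (y :+ z) :* con (+ 1) := (y :* con (+ 1) :+ z :* con (+ 1)) :* con (+ 1)) refl y z)))
  (fromℚᵘ-homo-+ (mkℚᵘ y 0) (mkℚᵘ z 0))
  where open ℤSolver.+-*-Solver

ι-* : ∀ y z → ι (y ℤ.* z) ≡ ι y ℚ.* ι z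
ι-* y z = fromℚᵘ-homo-* (mkℚᵘ y 0) (mkℚᵘ z 0)

ι-neg : ∀ z → ι (ℤ.- z) ≡ ℚ.- ι z
ι-neg z = inverseʳ-unique (ι z) (ι (ℤ.- z)) (trans (sym (ι-+ z (ℤ.- z))) (cong ι (ℤₚ.+-inverseʳ z)))
  where open import Algebra.Properties.Group ℚₚ.+-0-group

/-as-* : ∀ z d .{{_ : ℕ.NonZero d}} → z ℚ./ d ≡ ι z ℚ.* (1ℤ ℚ./ d)
/-as-* z (suc d) = trans
  (ℚₚ.fromℚᵘ-cong {mkℚᵘ z d} {mkℚᵘ z 0 ℚᵘ.* mkℚᵘ 1ℤ d}
    (*≡* (cong₂ ℤ._*_ (sym (ℤₚ.*-identityʳ z)) (ℤₚ.*-identityˡ (+ suc d)))))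
  (fromℚᵘ-homo-* (mkℚᵘ z 0) (mkℚᵘ 1ℤ d))

*-/-inverse : ∀ d .{{_ : ℕ.NonZero d}} → ι (+ d) ℚ.* (1ℤ ℚ./ d) ≡ 1ℚ
*-/-inverse (suc d) = trans (sym (/-as-* (+ suc d) (suc d)))
  (ℚₚ.fromℚᵘ-cong {mkℚᵘ (+ suc d) d} {mkℚᵘ 1ℤ 0} (*≡* (ℤₚ.*-comm (+ suc d) 1ℤ)))

ι-suc-inv! : ∀ n → ι (+ suc n) ℚ.* inv! (suc n) ≡ inv! n
ι-suc-inv! n = begin
  i ℚ.* inv! (suc n)
    ≡⟨ ℚₚ.*-identityʳ _ ⟨
  (i ℚ.* inv! (suc n)) ℚ.* 1ℚ
    ≡⟨ cong ((i ℚ.* inv! (suc n)) ℚ.*_) (*-/-inverse (n !)) ⟨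
  (i ℚ.* inv! (suc n)) ℚ.* (ι (+ (n !)) ℚ.* inv! n)
    ≡⟨ solve 4 (λ i k f g → (i :* k) :* (f :* g) := ((i :* f) :* k) :* g) refl i (inv! (suc n)) (ι (+ (n !))) (inv! n) ⟩
  ((i ℚ.* ι (+ (n !))) ℚ.* inv! (suc n)) ℚ.* inv! n
    ≡⟨ cong (λ q → (q ℚ.* inv! (suc n)) ℚ.* inv! n)
         (trans (sym (ι-* (+ suc n) (+ (n !)))) (cong ι (sym (ℤₚ.pos-* (suc n) (n !))))) ⟩
  (ι (+ (suc n !)) ℚ.* inv! (suc n)) ℚ.* inv! n
    ≡⟨ cong (ℚ._* inv! n) (*-/-inverse (suc n !)) ⟩
  1ℚ ℚ.* inv! n
    ≡⟨ ℚₚ.*-identityˡ _ ⟩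
  inv! n ∎
  where
  open ≡-Reasoning
  open ℚSolver.+-*-Solver
  i = ι (+ suc n)
  instance
    _ = n ℕₚ.!≢0
    _ = suc n ℕₚ.!≢0

convolution : Series → Series → Series
convolution f g zero    = f 0 ℚ.* g 0
convolution f g (suc n) = f 0 ℚ.* g (suc n) ℚ.+ convolution (f ∘ suc) g n

⊛-convolution : ∀ f g → f ⊛ g ≗ convolution f g
⊛-convolution f g n = trans (cong (foldr ℚ._+_ 0ℚ) (Listₚ.map-upTo (λ k → f k ℚ.* g (n ℕ.∸ k)) (suc n))) (go f n)
  where
  go : ∀ f n → foldr ℚ._+_ 0ℚ (applyUpTo (λ k → f k ℚ.* g (n ℕ.∸ k)) (suc n)) ≡ convolution f g n
  go f zero    = ℚₚ.+-identityʳ _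
  go f (suc n) = cong (f 0 ℚ.* g (suc n) ℚ.+_) (go (f ∘ suc) n)

convolution-cong : ∀ {f f′ g g′} → f ≗ f′ → g ≗ g′ → convolution f g ≗ convolution f′ g′
convolution-cong p q zero    = cong₂ ℚ._*_ (p 0) (q 0)
convolution-cong p q (suc n) = cong₂ ℚ._+_ (cong₂ ℚ._*_ (p 0) (q (suc n))) (convolution-cong (p ∘ suc) q n)

convolution-suc : ∀ f g n → convolution f g (suc n) ≡ convolution f (g ∘ suc) n ℚ.+ f (suc n) ℚ.* g 0
convolution-suc f g zero    = refl
convolution-suc f g (suc n) = trans
  (cong (f 0 ℚ.* g (suc (suc n)) ℚ.+_) (convolution-suc (f ∘ suc) g n))
  (sym (ℚₚ.+-assoc (f 0 ℚ.* g (suc (suc n))) _ _))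

-- θ 0 is the Euler operator x d/dx; the offset makes the Leibniz rule inductive.
θ : ℕ → Series → Series
θ m f k = ι (+ (m ℕ.+ k)) ℚ.* f k

-- In the term f k · g (n - k) the weight m + n splits as (m + k) + (n - k). Dropping the first
-- coefficient of `f` shifts its index by one, which the offset absorbs.
θ-convolution : ∀ m f g n → θ m (convolution f g) n ≡ convolution (θ m f) g n ℚ.+ convolution f (θ 0 g) n
θ-convolution m f g zero    =
  solve 3 (λ i f g → i :* (f :* g) := i :* f :* g :+ f :* (con 0ℚ :* g)) refl (ι (+ (m ℕ.+ 0))) (f 0) (g 0)
  where open ℚSolver.+-*-Solver
θ-convolution m f g (suc n) = begin
  ι (+ (m ℕ.+ suc n)) ℚ.* (f 0 ℚ.* g (suc n) ℚ.+ convolution f′ g n)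
    ≡⟨ ℚₚ.*-distribˡ-+ (ι (+ (m ℕ.+ suc n))) _ _ ⟩
  ι (+ (m ℕ.+ suc n)) ℚ.* (f 0 ℚ.* g (suc n)) ℚ.+ ι (+ (m ℕ.+ suc n)) ℚ.* convolution f′ g n
    ≡⟨ cong₂ ℚ._+_
         (cong (ℚ._* (f 0 ℚ.* g (suc n))) (ι-+ (+ m) (+ suc n)))
         (trans (cong (λ k → ι (+ k) ℚ.* convolution f′ g n) (ℕₚ.+-suc m n)) (θ-convolution (suc m) f′ g n)) ⟩
  (ι (+ m) ℚ.+ ι (+ suc n)) ℚ.* (f 0 ℚ.* g (suc n)) ℚ.+ (convolution (θ (suc m) f′) g n ℚ.+ convolution f′ (θ 0 g) n)
    ≡⟨ cong₂ (λ i q → (ι (+ i) ℚ.+ ι (+ suc n)) ℚ.* (f 0 ℚ.* g (suc n)) ℚ.+ (q ℚ.+ convolution f′ (θ 0 g) n))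
         (sym (ℕₚ.+-identityʳ m))
         (convolution-cong (λ k → cong (λ i → ι (+ i) ℚ.* f′ k) (sym (ℕₚ.+-suc m k))) (λ _ → refl) n) ⟩
  (ι (+ (m ℕ.+ 0)) ℚ.+ ι (+ suc n)) ℚ.* (f 0 ℚ.* g (suc n)) ℚ.+ (convolution (θ m f ∘ suc) g n ℚ.+ convolution f′ (θ 0 g) n)
    ≡⟨ solve 6 (λ i j f g p q → (i :+ j) :* (f :* g) :+ (p :+ q) := (i :* f :* g :+ p) :+ (f :* (j :* g) :+ q)) refl
         (ι (+ (m ℕ.+ 0))) (ι (+ suc n)) (f 0) (g (suc n)) _ _ ⟩
  convolution (θ m f) g (suc n) ℚ.+ convolution f (θ 0 g) (suc n) ∎
  where
  open ≡-Reasoning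
  open ℚSolver.+-*-Solver
  f′ = f ∘ suc

series : Sequence → Series
series α n = ι (α n) ℚ.* inv! n

θ-series : ∀ α n → θ 0 (series α) (suc n) ≡ series (D α) n
θ-series α n = trans
  (solve 3 (λ i a k → i :* (a :* k) := a :* (i :* k)) refl (ι (+ suc n)) (ι (α (suc n))) (inv! (suc n)))
  (cong (ι (α (suc n)) ℚ.*_) (ι-suc-inv! n))
  where open ℚSolver.+-*-Solver

series-+ : ∀ α β → series (α +ˢ β) ≗ series α ⊕ series β
series-+ α β n = trans (cong (ℚ._* inv! n) (ι-+ (α n) (β n))) (ℚₚ.*-distribʳ-+ (inv! n) (ι (α n)) (ι (β n)))

series-neg : ∀ α n → series (-ˢ α) n ≡ ℚ.- series α n
series-neg α n = trans (cong (ℚ._* inv! n) (ι-neg (α n))) (sym (ℚₚ.neg-distribˡ-* (ι (α n)) (inv! n)))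

ι-suc-cancelˡ : ∀ n {p q} → ι (+ suc n) ℚ.* p ≡ ι (+ suc n) ℚ.* q → p ≡ q
ι-suc-cancelˡ n {p} {q} eq = trans (sym (undo p)) (trans (cong ((1ℤ ℚ./ suc n) ℚ.*_) eq) (undo q))
  where
  undo : ∀ p → (1ℤ ℚ./ suc n) ℚ.* (ι (+ suc n) ℚ.* p) ≡ p
  undo p = trans (sym (ℚₚ.*-assoc (1ℤ ℚ./ suc n) (ι (+ suc n)) p))
    (trans (cong (ℚ._* p) (trans (ℚₚ.*-comm (1ℤ ℚ./ suc n) (ι (+ suc n))) (*-/-inverse (suc n)))) (ℚₚ.*-identityˡ p))

-- The Euler operator is a derivation for convolution and acts on `series` as the shift, so both
-- sides obey the same recursion; dividing by n + 1 recovers the coefficient. Binomial coefficients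
-- never appear.
series-*-convolution : ∀ α β → series (α *ˢ β) ≗ convolution (series α) (series β)
series-*-convolution α β zero    = trans (cong (ℚ._* inv! 0) (ι-* (α 0) (β 0)))
  (solve 2 (λ a b → (a :* b) :* con 1ℚ := (a :* con 1ℚ) :* (b :* con 1ℚ)) refl (ι (α 0)) (ι (β 0)))
  where open ℚSolver.+-*-Solver
series-*-convolution α β (suc n) = ι-suc-cancelˡ n (begin
  θ 0 (series (α *ˢ β)) (suc n)
    ≡⟨ θ-series (α *ˢ β) n ⟩
  series (D α *ˢ β +ˢ α *ˢ D β) n
    ≡⟨ series-+ (D α *ˢ β) (α *ˢ D β) n ⟩
  series (D α *ˢ β) n ℚ.+ series (α *ˢ D β) n
    ≡⟨ cong₂ ℚ._+_ (series-*-convolution (D α) β n) (series-*-convolution α (D β) n) ⟩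
  convolution (series (D α)) (series β) n ℚ.+ convolution (series α) (series (D β)) n
    ≡⟨ cong₂ ℚ._+_
         (convolution-cong (θ-series α) (λ _ → refl) n)
         (convolution-cong (λ _ → refl) (θ-series β) n) ⟨
  convolution (θ 0 (series α) ∘ suc) (series β) n ℚ.+ convolution (series α) (θ 0 (series β) ∘ suc) n
    ≡⟨ cong₂ ℚ._+_
         (solve 3 (λ a b p → con 0ℚ :* a :* b :+ p := p) refl (series α 0) (series β (suc n)) _)
         (trans (convolution-suc (series α) (θ 0 (series β)) n)
           (solve 3 (λ a b p → p :+ a :* (con 0ℚ :* b) := p) refl (series α (suc n)) (series β 0) _)) ⟨
  convolution (θ 0 (series α)) (series β) (suc n) ℚ.+ convolution (series α) (θ 0 (series β)) (suc n)
    ≡⟨ θ-convolution 0 (series α) (series β) (suc n) ⟨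
  θ 0 (convolution (series α) (series β)) (suc n) ∎)
  where
  open ≡-Reasoning
  open ℚSolver.+-*-Solver

infix 4 _represents_
-- A record rather than a bare pointwise equation, so that both the series and the sequence can be
-- inferred when closed forms are assembled.
record _represents_ (f : Series) (α : Sequence) : Set where
  field coefficients : f ≗ series α
open _represents_

represents-⊛ : ∀ {f g α β} → f represents α → g represents β → f ⊛ g represents α *ˢ β
coefficients (represents-⊛ {f} {g} {α} {β} p q) n = trans (⊛-convolution f g n)
  (trans (convolution-cong (coefficients p) (coefficients q) n) (sym (series-*-convolution α β n)))

represents-⊕ : ∀ {f g α β} → f represents α → g represents β → f ⊕ g represents α +ˢ β
coefficients (represents-⊕ {α = α} {β} p q) n = trans (cong₂ ℚ._+_ (coefficients p n) (coefficients q n)) (sym (series-+ α β n))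

represents-⊖ : ∀ {f g α β} → f represents α → g represents β → f ⊖ g represents α +ˢ -ˢ β
coefficients (represents-⊖ {α = α} {β} p q) n = trans (cong₂ ℚ._-_ (coefficients p n) (coefficients q n))
  (trans (cong (series α n ℚ.+_) (sym (series-neg β n))) (sym (series-+ α (-ˢ β) n)))

egf-represents : ∀ a → egf a represents (λ n → + a n)
coefficients (egf-represents a) n = /-as-* (+ a n) (n !)
  where instance _ = n ℕₚ.!≢0

represents-≗ : ∀ {f g α β} → f represents α → α ≗ β → g represents β → f ≗ g
represents-≗ p eq q n = trans (coefficients p n)
  (trans (cong (λ z → ι z ℚ.* inv! n) (eq n)) (sym (coefficients q n)))

-- Sums over permutations

Weight : Set
Weight = List ℕ → ℤ

total : Weight → List (List ℕ) → ℤ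
total g []       = 0ℤ
total g (l ∷ ls) = g l ℤ.+ total g ls

splitSum : (List ℕ → List ℕ → ℤ) → List ℕ → ℤ
splitSum h []       = h [] []
splitSum h (y ∷ ys) = h [] (y ∷ ys) ℤ.+ splitSum (λ u v → h (y ∷ u) v) ys

insertSum : ℕ → Weight → Weight
insertSum x g = splitSum (λ u v → g (u ++ x ∷ v))

-- Insertion is moved from the lists onto the weight: `insertSum x` is the transpose of
-- `insertions x`, so a sum over permutations becomes a recursion on weights.
permSum : Weight → Weight
permSum g []       = g []
permSum g (x ∷ xs) = permSum (insertSum x g) xs

-- The recursion is the one that defines `*ˢ`: each entry goes to one of two subsequences, as each
-- derivative falls on one of two factors.
unshuffleSum : (List ℕ → List ℕ → ℤ) → List ℕ → ℤ
unshuffleSum f []       = f [] []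
unshuffleSum f (x ∷ xs) = unshuffleSum (λ as bs → f (x ∷ as) bs) xs ℤ.+ unshuffleSum (λ as bs → f as (x ∷ bs)) xs

total-++ : ∀ g ls ms → total g (ls ++ ms) ≡ total g ls ℤ.+ total g ms
total-++ g []       ms = sym (ℤₚ.+-identityˡ _)
total-++ g (l ∷ ls) ms = trans (cong (λ z → g l ℤ.+ z) (total-++ g ls ms)) (sym (ℤₚ.+-assoc (g l) _ _))

total-map : ∀ g (f : List ℕ → List ℕ) ls → total g (map f ls) ≡ total (g ∘ f) ls
total-map g f []       = refl
total-map g f (l ∷ ls) = cong (λ z → g (f l) ℤ.+ z) (total-map g f ls)

total-insertions : ∀ g x σ → total g (insertions x σ) ≡ insertSum x g σ
total-insertions g x []       = ℤₚ.+-identityʳ _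
total-insertions g x (y ∷ ys) = cong (λ z → g (x ∷ y ∷ ys) ℤ.+ z)
  (trans (total-map g (y ∷_) (insertions x ys)) (total-insertions (g ∘ (y ∷_)) x ys))

total-concatMap-insertions : ∀ g x ls → total g (concatMap (insertions x) ls) ≡ total (insertSum x g) ls
total-concatMap-insertions g x []       = refl
total-concatMap-insertions g x (l ∷ ls) = trans (total-++ g (insertions x l) _)
  (cong₂ ℤ._+_ (total-insertions g x l) (total-concatMap-insertions g x ls))

total-perms : ∀ g xs → total g (perms xs) ≡ permSum g xs
total-perms g []       = ℤₚ.+-identityʳ _
total-perms g (x ∷ xs) = trans (total-concatMap-insertions g x (perms xs)) (total-perms (insertSum x g) xs)

indicator : (List ℕ → Bool) → Weight
indicator p l = if p l then 1ℤ else 0ℤ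

length-filterᵇ : ∀ p ls → + length (filterᵇ p ls) ≡ total (indicator p) ls
length-filterᵇ p []       = refl
length-filterᵇ p (l ∷ ls) with p l
... | true  = cong (λ z → 1ℤ ℤ.+ z) (length-filterᵇ p ls)
... | false = trans (length-filterᵇ p ls) (sym (ℤₚ.+-identityˡ _))

module _ {Q : ℕ → Set} where

  -- The predicate `Q` carries the fact that all remaining entries exceed the removed one, without
  -- which the decomposition at the minimum fails.
  splitSum-cong-All : ∀ {h h′ σ} → (∀ {u v} → All Q u → All Q v → h u v ≡ h′ u v) →
                      All Q σ → splitSum h σ ≡ splitSum h′ σ
  splitSum-cong-All eq []       = eq [] []
  splitSum-cong-All eq (q ∷ qs) = cong₂ ℤ._+_ (eq [] (q ∷ qs)) (splitSum-cong-All (λ qu qv → eq (q ∷ qu) qv) qs)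

  permSum-cong-All : ∀ {g g′ xs} → (∀ {σ} → All Q σ → g σ ≡ g′ σ) → All Q xs → permSum g xs ≡ permSum g′ xs
  permSum-cong-All eq []       = eq []
  permSum-cong-All eq (q ∷ qs) =
    permSum-cong-All (splitSum-cong-All (λ qu qv → eq (Allₚ.++⁺ qu (q ∷ qv)))) qs

splitSum-cong : ∀ {h h′} → (∀ u v → h u v ≡ h′ u v) → splitSum h ≗ splitSum h′
splitSum-cong eq σ = splitSum-cong-All {Q = λ _ → ⊤} (λ _ _ → eq _ _) (All.universal _ σ)

permSum-cong : ∀ {g g′} → g ≗ g′ → permSum g ≗ permSum g′
permSum-cong eq xs = permSum-cong-All {Q = λ _ → ⊤} (λ _ → eq _) (All.universal _ xs)

interchange : ∀ i j k l → (i ℤ.+ j) ℤ.+ (k ℤ.+ l) ≡ (i ℤ.+ k) ℤ.+ (j ℤ.+ l)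
interchange = solve 4 (λ i j k l → (i :+ j) :+ (k :+ l) := (i :+ k) :+ (j :+ l)) refl
  where open ℤSolver.+-*-Solver

splitSum-+ : ∀ h k → splitSum (λ u v → h u v ℤ.+ k u v) ≗ λ σ → splitSum h σ ℤ.+ splitSum k σ
splitSum-+ h k []       = refl
splitSum-+ h k (y ∷ ys) = trans
  (cong (λ z → (h [] (y ∷ ys) ℤ.+ k [] (y ∷ ys)) ℤ.+ z) (splitSum-+ (h ∘ (y ∷_)) (k ∘ (y ∷_)) ys))
  (interchange (h [] (y ∷ ys)) (k [] (y ∷ ys)) _ _)

splitSum-*ˡ : ∀ z h → splitSum (λ u v → z ℤ.* h u v) ≗ λ σ → z ℤ.* splitSum h σ
splitSum-*ˡ z h []       = refl
splitSum-*ˡ z h (y ∷ ys) = trans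
  (cong (λ w → z ℤ.* h [] (y ∷ ys) ℤ.+ w) (splitSum-*ˡ z (h ∘ (y ∷_)) ys))
  (sym (ℤₚ.*-distribˡ-+ z _ _))

splitSum-*ʳ : ∀ z h → splitSum (λ u v → h u v ℤ.* z) ≗ λ σ → splitSum h σ ℤ.* z
splitSum-*ʳ z h σ = trans (splitSum-cong (λ u v → ℤₚ.*-comm (h u v) z) σ)
  (trans (splitSum-*ˡ z h σ) (ℤₚ.*-comm z _))

permSum-+ : ∀ g k → permSum (λ σ → g σ ℤ.+ k σ) ≗ λ xs → permSum g xs ℤ.+ permSum k xs
permSum-+ g k []       = refl
permSum-+ g k (x ∷ xs) = trans (permSum-cong (splitSum-+ _ _) xs) (permSum-+ (insertSum x g) (insertSum x k) xs)

-- After insertion and cutting, `x` lies in exactly one of the two pieces, and deleting it there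
-- leaves a cut of the original list.
insertSum-splitSum : ∀ x h → insertSum x (splitSum h) ≗
  splitSum (λ u v → insertSum x (λ w → h w v) u ℤ.+ insertSum x (h u) v)
insertSum-splitSum x h []       = ℤₚ.+-comm (h [] (x ∷ [])) _
insertSum-splitSum x h (y ∷ ys) = begin
  (h⁰ ℤ.+ (h¹ ℤ.+ splitSum h₁ ys)) ℤ.+ splitSum (λ u v → h [] (y ∷ u ++ x ∷ v) ℤ.+ splitSum hʸ (u ++ x ∷ v)) ys
    ≡⟨ cong (λ z → (h⁰ ℤ.+ (h¹ ℤ.+ splitSum h₁ ys)) ℤ.+ z)
         (trans (splitSum-+ _ _ ys) (cong (λ z → splitSum h₂ ys ℤ.+ z) (insertSum-splitSum x hʸ ys))) ⟩
  (h⁰ ℤ.+ (h¹ ℤ.+ splitSum h₁ ys)) ℤ.+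
  (splitSum h₂ ys ℤ.+ splitSum (λ u v → insertSum x (λ w → hʸ w v) u ℤ.+ insertSum x (hʸ u) v) ys)
    ≡⟨ cong (λ z → (h⁰ ℤ.+ (h¹ ℤ.+ splitSum h₁ ys)) ℤ.+ (splitSum h₂ ys ℤ.+ z)) (splitSum-+ _ _ ys) ⟩
  (h⁰ ℤ.+ (h¹ ℤ.+ splitSum h₁ ys)) ℤ.+ (splitSum h₂ ys ℤ.+ (splitSum h₃ ys ℤ.+ splitSum h₄ ys))
    ≡⟨ rearrange h⁰ h¹ _ _ _ _ ⟩
  (h¹ ℤ.+ (h⁰ ℤ.+ splitSum h₂ ys)) ℤ.+ ((splitSum h₁ ys ℤ.+ splitSum h₃ ys) ℤ.+ splitSum h₄ ys)
    ≡⟨ cong (λ z → (h¹ ℤ.+ (h⁰ ℤ.+ splitSum h₂ ys)) ℤ.+ z)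
         (trans (splitSum-+ _ _ ys) (cong (λ z → z ℤ.+ splitSum h₄ ys) (splitSum-+ _ _ ys))) ⟨
  (h¹ ℤ.+ (h⁰ ℤ.+ splitSum h₂ ys)) ℤ.+ splitSum (λ u v → (h₁ u v ℤ.+ h₃ u v) ℤ.+ h₄ u v) ys ∎
  where
  open ≡-Reasoning
  h⁰ = h [] (x ∷ y ∷ ys)
  h¹ = h (x ∷ []) (y ∷ ys)
  hʸ = λ u → h (y ∷ u)
  h₁ = λ u v → h (x ∷ y ∷ u) v
  h₂ = λ u v → h [] (y ∷ u ++ x ∷ v)
  h₃ = λ u v → insertSum x (λ w → hʸ w v) u
  h₄ = λ u v → insertSum x (hʸ u) v
  open ℤSolver.+-*-Solver
  rearrange : ∀ a b p q r s → (a ℤ.+ (b ℤ.+ p)) ℤ.+ (q ℤ.+ (r ℤ.+ s)) ≡ (b ℤ.+ (a ℤ.+ q)) ℤ.+ ((p ℤ.+ r) ℤ.+ s)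
  rearrange = solve 6 (λ a b p q r s → (a :+ (b :+ p)) :+ (q :+ (r :+ s)) := (b :+ (a :+ q)) :+ ((p :+ r) :+ s)) refl

_⊠_ : Weight → Weight → List ℕ → List ℕ → ℤ
(g ⊠ k) u v = g u ℤ.* k v

-- By `insertSum-splitSum`, inserting `x` acts on a product of weights as a derivation, and its two
-- terms are the two branches of `unshuffleSum`. Combinatorially, a permutation with a cut is a
-- distribution of the entries together with an independent permutation of each part.
permSum-splitSum-⊠ : ∀ g k → permSum (splitSum (g ⊠ k)) ≗ unshuffleSum (permSum g ⊠ permSum k)
permSum-splitSum-⊠ g k []       = refl
permSum-splitSum-⊠ g k (x ∷ xs) = begin
  permSum (insertSum x (splitSum (g ⊠ k))) xs
    ≡⟨ permSum-cong (λ σ → trans (insertSum-splitSum x (g ⊠ k) σ) (trans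
         (splitSum-cong (λ u v → cong₂ ℤ._+_
           (splitSum-*ʳ (k v) (λ u v → g (u ++ x ∷ v)) u) (splitSum-*ˡ (g u) (λ u v → k (u ++ x ∷ v)) v)) σ)
         (splitSum-+ (insertSum x g ⊠ k) (g ⊠ insertSum x k) σ))) xs ⟩
  permSum (λ σ → splitSum (insertSum x g ⊠ k) σ ℤ.+ splitSum (g ⊠ insertSum x k) σ) xs
    ≡⟨ permSum-+ (splitSum (insertSum x g ⊠ k)) (splitSum (g ⊠ insertSum x k)) xs ⟩
  permSum (splitSum (insertSum x g ⊠ k)) xs ℤ.+ permSum (splitSum (g ⊠ insertSum x k)) xs
    ≡⟨ cong₂ ℤ._+_ (permSum-splitSum-⊠ (insertSum x g) k xs) (permSum-splitSum-⊠ g (insertSum x k) xs) ⟩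
  unshuffleSum (permSum g ⊠ permSum k) (x ∷ xs) ∎
  where open ≡-Reasoning

unshuffleSum-length : ∀ {f : List ℕ → List ℕ → ℤ} α β xs →
  (∀ {as bs} → as ⊆ xs → bs ⊆ xs → f as bs ≡ α (length as) ℤ.* β (length bs)) →
  unshuffleSum f xs ≡ (α *ˢ β) (length xs)
unshuffleSum-length α β []       eq = eq [] []
unshuffleSum-length α β (x ∷ xs) eq = cong₂ ℤ._+_
  (unshuffleSum-length (D α) β xs (λ p q → eq (refl ∷ p) (x ∷ʳ q)))
  (unshuffleSum-length α (D β) xs (λ p q → eq (x ∷ʳ p) (refl ∷ q)))

Increasing : List ℕ → Set
Increasing = AllPairs ℕ._<_

Increasing-resp-⊆ : ∀ {as xs} → as ⊆ xs → Increasing xs → Increasing as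
Increasing-resp-⊆ []         []          = []
Increasing-resp-⊆ (_ ∷ʳ p)   (_ ∷ inc)   = Increasing-resp-⊆ p inc
Increasing-resp-⊆ (refl ∷ p) (x< ∷ inc)  = All-resp-⊆ p x< ∷ Increasing-resp-⊆ p inc

-- Only relative order should matter, so the sum over an increasing list should depend on its length
-- alone. The bound lets this serve as an induction hypothesis for the two pieces of a cut.
_HasCounts_UpTo_ : Weight → Sequence → ℕ → Set
g HasCounts α UpTo n = ∀ {xs} → Increasing xs → length xs ℕ.≤ n → permSum g xs ≡ α (length xs)

permSum-splitSum-counts : ∀ {g k α β xs} → g HasCounts α UpTo length xs → k HasCounts β UpTo length xs →
  Increasing xs → permSum (splitSum (g ⊠ k)) xs ≡ (α *ˢ β) (length xs)
permSum-splitSum-counts {g} {k} {α} {β} {xs} p q inc = trans (permSum-splitSum-⊠ g k xs)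
  (unshuffleSum-length α β xs λ as⊆ bs⊆ → cong₂ ℤ._*_
    (p (Increasing-resp-⊆ as⊆ inc) (length-mono-≤ as⊆)) (q (Increasing-resp-⊆ bs⊆ inc) (length-mono-≤ bs⊆)))

length-map-applyUpTo : ∀ (f : ℕ → ℕ) n → length (map suc (applyUpTo f n)) ≡ n
length-map-applyUpTo f n = trans (Listₚ.length-map suc (applyUpTo f n)) (Listₚ.length-applyUpTo f n)

range-increasing : ∀ n → Increasing (range n)
range-increasing n = AllPairsₚ.map⁺ (AllPairsₚ.applyUpTo⁺₁ (λ i → i) n (λ i<j _ → s≤s i<j))

-- Permutations with boundary conditions

-- Peaks and valleys are permitted at every second position.  A boundary says
-- what holds at an end of a list: the extreme position permits them (turn), or
-- it does not and nothing lies beyond it (straight), or it does not and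
-- a smaller entry lies beyond it (floor).
data Boundary : Set where
  turn straight floor : Boundary

data Step : Set where
  up down flat : Step

-- The current entry is `free` at a permitted position; at a forbidden one it remembers the step
-- that led to it. The step `flat` covers both an end with nothing beyond it and equal neighbours,
-- since neither can create a peak or valley.
data Status : Set where
  free  : Status
  after : Step → Status

start : Boundary → Status
start turn     = free
start straight = after flat
start floor    = after up

step : ℕ → ℕ → Step
step y z = if y <ᵇ z then up else if z <ᵇ y then down else flat

-- At the last entry the status must match the right boundary, which fixes the parity of the length.
-- With `floor`, a last entry reached by `up` would be a forbidden peak.
scan : Status → ℕ → List ℕ → Boundary → ℤ
scan free         y []       turn     = 1ℤ
scan free         y []       straight = 0ℤ
scan free         y []       floor    = 0ℤ
scan (after _)    y []       turn     = 0ℤ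
scan (after _)    y []       straight = 1ℤ
scan (after up)   y []       floor    = 0ℤ
scan (after down) y []       floor    = 1ℤ
scan (after flat) y []       floor    = 1ℤ
scan free         y (z ∷ zs) t        = scan (after (step y z)) z zs t
scan (after up)   y (z ∷ zs) t        = if z <ᵇ y then 0ℤ else scan free z zs t
scan (after down) y (z ∷ zs) t        = if y <ᵇ z then 0ℤ else scan free z zs t
scan (after flat) y (z ∷ zs) t        = scan free z zs t

-- The boundaries determine the parity of the length; the empty list counts as even.
weight : Boundary → Boundary → Weight
weight s        t        (y ∷ ys) = scan (start s) y ys t
weight turn     turn     []       = 0ℤ
weight turn     straight []       = 1ℤ
weight turn     floor    []       = 1ℤ
weight straight turn     []       = 1ℤ
weight floor    turn     []       = 1ℤ
weight straight straight []       = 0ℤ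
weight straight floor    []       = 0ℤ
weight floor    straight []       = 0ℤ
weight floor    floor    []       = 0ℤ

emptyWeight : ℤ → Weight
emptyWeight z []      = z
emptyWeight z (_ ∷ _) = 0ℤ

-- Tells whether the minimum may stand at this end in a forbidden position. At a `turn` end the
-- extreme position is permitted, a case that belongs to the product of two `floor` pieces.
ν : Boundary → ℤ
ν turn     = 0ℤ
ν straight = 1ℤ
ν floor    = 1ℤ

-- Correction for a singleton, which is both first and last and so is counted by both end terms. One
-- count is excess when neither end is `turn`; with `floor` on both sides the entry is a forbidden
-- peak, so both counts are.
κ : Boundary → Boundary → ℤ
κ turn     _        = 0ℤ
κ straight turn     = 0ℤ
κ straight straight = 1ℤ
κ straight floor    = 1ℤ
κ floor    turn     = 0ℤ
κ floor    straight = 1ℤ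
κ floor    floor    = + 2

<⇒<ᵇ≡true : ∀ {m n} → m ℕ.< n → (m <ᵇ n) ≡ true
<⇒<ᵇ≡true {m} {n} m<n with m <ᵇ n | ℕₚ.<⇒<ᵇ m<n
... | true | _ = refl

<⇒>ᵇ≡false : ∀ {m n} → m ℕ.< n → (n <ᵇ m) ≡ false
<⇒>ᵇ≡false {m} {n} m<n with n <ᵇ m in eq
... | false = refl
... | true  = contradiction (ℕₚ.<ᵇ⇒< n m (subst T (sym eq) _)) (ℕₚ.<-asym m<n)

private
  1*i+0 : ∀ i → 1ℤ ℤ.* i ℤ.+ 0ℤ ≡ i
  1*i+0 i = trans (ℤₚ.+-identityʳ _) (ℤₚ.*-identityˡ i)

  0+1*i : ∀ i → 0ℤ ℤ.+ 1ℤ ℤ.* i ≡ i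
  0+1*i i = trans (ℤₚ.+-identityˡ _) (ℤₚ.*-identityˡ i)

-- Every later entry exceeds `x`, so the step leaving `x` is `up`, which is exactly how a `floor`
-- start begins.
scan-free-floor : ∀ {x v} t → All (x ℕ.<_) v → scan free x v t ≡ weight floor t v
scan-free-floor turn     []        = refl
scan-free-floor straight []        = refl
scan-free-floor floor    []        = refl
scan-free-floor t        (x<z ∷ _) rewrite <⇒<ᵇ≡true x<z = refl

-- Here `x` is reached by descent at a forbidden position, so any further entry would make it a
-- valley.
scan-down : ∀ {x v} t → All (x ℕ.<_) v → scan (after down) x v t ≡ emptyWeight (ν t) v
scan-down turn     []        = refl
scan-down straight []        = refl
scan-down floor    []        = refl
scan-down t        (x<z ∷ _) rewrite <⇒<ᵇ≡true x<z = refl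

-- The two products are the two parities of the position of `x`. If it is permitted, the left piece
-- ends at a forbidden position beside a smaller entry. If it is forbidden, the left piece ends at a
-- permitted one and nothing may follow `x`.
scan-++ : ∀ {x y u v} s t → x ℕ.< y → All (x ℕ.<_) u → All (x ℕ.<_) v →
  scan s y (u ++ x ∷ v) t ≡ scan s y u floor ℤ.* weight floor t v ℤ.+ scan s y u turn ℤ.* emptyWeight (ν t) v
scan-++ {v = v} free t x<y [] qv rewrite <⇒<ᵇ≡true x<y | <⇒>ᵇ≡false x<y =
  trans (scan-down t qv) (sym (0+1*i (emptyWeight (ν t) v)))
scan-++ (after up) t x<y [] qv rewrite <⇒<ᵇ≡true x<y = refl
scan-++ {v = v} (after down) t x<y [] qv rewrite <⇒>ᵇ≡false x<y =
  trans (scan-free-floor t qv) (sym (1*i+0 (weight floor t v)))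
scan-++ {v = v} (after flat) t x<y [] qv =
  trans (scan-free-floor t qv) (sym (1*i+0 (weight floor t v)))
scan-++ {y = y} free t x<y (_∷_ {x = z} x<z qu) qv = scan-++ (after (step y z)) t x<z qu qv
scan-++ {y = y} (after up) t x<y (_∷_ {x = z} x<z qu) qv with z <ᵇ y
... | true  = refl
... | false = scan-++ free t x<z qu qv
scan-++ {y = y} (after down) t x<y (_∷_ {x = z} x<z qu) qv with y <ᵇ z
... | true  = refl
... | false = scan-++ free t x<z qu qv
scan-++ (after flat) t x<y (x<z ∷ qu) qv = scan-++ free t x<z qu qv

-- In order: the minimum at a permitted position, first at a forbidden one, last at a forbidden one,
-- and the singleton correction. A neighbour of a forbidden position is permitted, whence the `turn`
-- boundaries.
decomposition : Boundary → Boundary → List ℕ → List ℕ → ℤ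
decomposition s t u v =
  ((weight s floor ⊠ weight floor t) u v ℤ.+ (emptyWeight (ν s) ⊠ weight turn t) u v) ℤ.+
  ((weight s turn ⊠ emptyWeight (ν t)) u v ℤ.+ (emptyWeight (ℤ.- κ s t) ⊠ emptyWeight 1ℤ) u v)

weight-minimum : ∀ {x u v} s t → All (x ℕ.<_) u → All (x ℕ.<_) v →
  weight s t (u ++ x ∷ v) ≡ decomposition s t u v
weight-minimum turn     turn     [] []        = refl
weight-minimum turn     straight [] []        = refl
weight-minimum turn     floor    [] []        = refl
weight-minimum straight turn     [] []        = refl
weight-minimum straight straight [] []        = refl
weight-minimum straight floor    [] []        = refl
weight-minimum floor    turn     [] []        = refl
weight-minimum floor    straight [] []        = refl
weight-minimum floor    floor    [] []        = refl
weight-minimum {v = v@(_ ∷ _)} turn t [] qv = trans (scan-free-floor t qv) (sym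
  (trans (ℤₚ.+-identityʳ _) (1*i+0 (weight floor t v))))
weight-minimum {v = v@(_ ∷ _)} straight t [] qv = sym (trans
  (cong₂ ℤ._+_ (0+1*i (weight turn t v)) (trans (ℤₚ.+-identityˡ _) (ℤₚ.*-zeroʳ (ℤ.- κ straight t)))) (ℤₚ.+-identityʳ _))
weight-minimum {v = v@(_ ∷ _)} floor t [] (x<z ∷ qv) rewrite <⇒>ᵇ≡false x<z = sym (trans
  (cong₂ ℤ._+_ (0+1*i (weight turn t v)) (trans (ℤₚ.+-identityˡ _) (ℤₚ.*-zeroʳ (ℤ.- κ floor t)))) (ℤₚ.+-identityʳ _))
weight-minimum {u = y ∷ u} {v} s t (x<y ∷ qu) qv = trans (scan-++ (start s) t x<y qu qv)
  (sym (cong₂ ℤ._+_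
    (ℤₚ.+-identityʳ (scan (start s) y u floor ℤ.* weight floor t v))
    (ℤₚ.+-identityʳ (scan (start s) y u turn ℤ.* emptyWeight (ν t) v))))

-- Differential recurrences for the counts

count : Boundary → Boundary → Sequence
count s t n = permSum (weight s t) (range n)

-- The image of `decomposition` when `⊠` becomes `*ˢ` and `emptyWeight z` becomes `constant z`.
countDerivative : Boundary → Boundary → Sequence
countDerivative s t =
  (count s floor *ˢ count floor t +ˢ constant (ν s) *ˢ count turn t) +ˢ
  (count s turn *ˢ constant (ν t) +ˢ constant (ℤ.- κ s t) *ˢ constant 1ℤ)

splitSum-zero : splitSum (λ _ _ → 0ℤ) ≗ λ _ → 0ℤ
splitSum-zero []       = refl
splitSum-zero (y ∷ ys) = trans (ℤₚ.+-identityˡ _) (splitSum-zero ys)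

permSum-zero : permSum (λ _ → 0ℤ) ≗ λ _ → 0ℤ
permSum-zero []       = refl
permSum-zero (x ∷ xs) = trans (permSum-cong splitSum-zero xs) (permSum-zero xs)

permSum-emptyWeight : ∀ z xs → permSum (emptyWeight z) xs ≡ constant z (length xs)
permSum-emptyWeight z []       = refl
permSum-emptyWeight z (x ∷ xs) = trans
  (permSum-cong (λ σ → trans (splitSum-cong inhabited σ) (splitSum-zero σ)) xs) (permSum-zero xs)
  where
  inhabited : ∀ u v → emptyWeight z (u ++ x ∷ v) ≡ 0ℤ
  inhabited []      v = refl
  inhabited (_ ∷ _) v = refl

permSum-weight-∷ : ∀ s t {x xs} → (∀ s t → weight s t HasCounts count s t UpTo length xs) →
  Increasing (x ∷ xs) → permSum (weight s t) (x ∷ xs) ≡ countDerivative s t (length xs)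
permSum-weight-∷ s t {x} {xs} counts (x< ∷ inc) = begin
  permSum (insertSum x (weight s t)) xs
    ≡⟨ permSum-cong-All (splitSum-cong-All (weight-minimum s t)) x< ⟩
  permSum (splitSum (decomposition s t)) xs
    ≡⟨ permSum-cong (λ σ → trans (splitSum-+ _ _ σ) (cong₂ ℤ._+_
         (splitSum-+ (weight s floor ⊠ weight floor t) (emptyWeight (ν s) ⊠ weight turn t) σ)
         (splitSum-+ (weight s turn ⊠ emptyWeight (ν t)) (emptyWeight (ℤ.- κ s t) ⊠ emptyWeight 1ℤ) σ))) xs ⟩
  permSum (λ σ → (splitSum (weight s floor ⊠ weight floor t) σ ℤ.+ splitSum (emptyWeight (ν s) ⊠ weight turn t) σ) ℤ.+
                 (splitSum (weight s turn ⊠ emptyWeight (ν t)) σ ℤ.+ splitSum (emptyWeight (ℤ.- κ s t) ⊠ emptyWeight 1ℤ) σ)) xs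
    ≡⟨ trans (permSum-+ _ _ xs) (cong₂ ℤ._+_
         (permSum-+ (splitSum (weight s floor ⊠ weight floor t)) (splitSum (emptyWeight (ν s) ⊠ weight turn t)) xs)
         (permSum-+ (splitSum (weight s turn ⊠ emptyWeight (ν t))) (splitSum (emptyWeight (ℤ.- κ s t) ⊠ emptyWeight 1ℤ)) xs)) ⟩
  (permSum (splitSum (weight s floor ⊠ weight floor t)) xs ℤ.+ permSum (splitSum (emptyWeight (ν s) ⊠ weight turn t)) xs) ℤ.+
  (permSum (splitSum (weight s turn ⊠ emptyWeight (ν t))) xs ℤ.+ permSum (splitSum (emptyWeight (ℤ.- κ s t) ⊠ emptyWeight 1ℤ)) xs)
    ≡⟨ cong₂ ℤ._+_
         (cong₂ ℤ._+_ (product (counts s floor) (counts floor t)) (product (empty (ν s)) (counts turn t)))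
         (cong₂ ℤ._+_ (product (counts s turn) (empty (ν t))) (product (empty (ℤ.- κ s t)) (empty 1ℤ))) ⟩
  countDerivative s t (length xs) ∎
  where
  open ≡-Reasoning
  product : ∀ {g k α β} → g HasCounts α UpTo length xs → k HasCounts β UpTo length xs →
            permSum (splitSum (g ⊠ k)) xs ≡ (α *ˢ β) (length xs)
  product p q = permSum-splitSum-counts p q inc
  empty : ∀ z → emptyWeight z HasCounts constant z UpTo length xs
  empty z {ys} _ _ = permSum-emptyWeight z ys

count-suc : ∀ n → (∀ s t → weight s t HasCounts count s t UpTo n) →
            ∀ s t → count s t (suc n) ≡ countDerivative s t n
count-suc n counts s t = trans
  (permSum-weight-∷ s t (subst (λ m → ∀ s t → weight s t HasCounts count s t UpTo m) (sym len) counts) (range-increasing (suc n)))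
  (cong (countDerivative s t) len)
  where len = length-map-applyUpTo suc n

-- An increasing list and the `range` of the same length both reduce to `countDerivative` at the
-- length of the tail, where the claim is already known for all boundaries.
weight-counts : ∀ n s t → weight s t HasCounts count s t UpTo n
weight-counts n       s t {[]}     _   _         = refl
weight-counts (suc n) s t {x ∷ xs} inc (s≤s len) =
  trans (permSum-weight-∷ s t counts inc) (sym (count-suc (length xs) counts s t))
  where
  counts : ∀ s t → weight s t HasCounts count s t UpTo length xs
  counts s t inc′ len′ = weight-counts n s t inc′ (ℕₚ.≤-trans len′ len)

D-count : ∀ s t → D (count s t) ≗ countDerivative s t
D-count s t n = count-suc n (weight-counts n) s t

-- Peak and valley conditions as boundary weights

bit : Bool → ℤ
bit p = if p then 1ℤ else 0ℤ

-- Summing over the two boundaries admits lists of either parity.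
scan₂ : Status → ℕ → List ℕ → ℤ
scan₂ s y ys = scan s y ys turn ℤ.+ scan s y ys straight

isEven-suc : ∀ n → isEven (suc n) ≡ not (isEven n)
isEven-suc zero          = refl
isEven-suc (suc zero)    = refl
isEven-suc (suc (suc n)) = isEven-suc n

isOdd-suc : ∀ n → isOdd (suc n) ≡ not (isOdd n)
isOdd-suc zero          = refl
isOdd-suc (suc zero)    = refl
isOdd-suc (suc (suc n)) = isOdd-suc n

scan-after : ∀ x y z zs t → scan (after (step x y)) y (z ∷ zs) t ≡
             (if isPeak x y z ∨ isValley x y z then 0ℤ else scan free z zs t)
scan-after x y z zs t with x <ᵇ y in x<y | y <ᵇ x in y<x
... | true  | true  = contradiction (ℕₚ.<ᵇ⇒< y x (subst T (sym y<x) _)) (ℕₚ.<-asym (ℕₚ.<ᵇ⇒< x y (subst T (sym x<y) _)))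
... | false | false = refl
... | false | true with y <ᵇ z
...   | true  = refl
...   | false = refl
scan-after x y z zs t | true | false with z <ᵇ y
...   | true  = refl
...   | false = refl

module _ {P : ℕ → Bool} (P-suc : ∀ i → P (suc i) ≡ not (P i)) where

  -- Since `P` alternates, its value at the current index is the distinction between `free` and
  -- `after`, and the two statements hand over to each other at each entry.
  allPV-free  : ∀ i x y ys → P i ≡ true → bit (allPV' P i (x ∷ y ∷ ys)) ≡ scan₂ free y ys
  allPV-after : ∀ i x y ys → P i ≡ false → bit (allPV' P i (x ∷ y ∷ ys)) ≡ scan₂ (after (step x y)) y ys

  allPV-free i x y []       _  = refl
  allPV-free i x y (z ∷ zs) Pi rewrite Pi with isPeak x y z ∨ isValley x y z
  ... | true  = allPV-after (suc i) y z zs (trans (P-suc i) (cong not Pi))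
  ... | false = allPV-after (suc i) y z zs (trans (P-suc i) (cong not Pi))

  allPV-after i x y [] _ = refl
  allPV-after i x y (z ∷ zs) Pi
    rewrite Pi | scan-after x y z zs turn | scan-after x y z zs straight with isPeak x y z ∨ isValley x y z
  ... | true  = refl
  ... | false = allPV-free (suc i) y z zs (trans (P-suc i) (cong not Pi))

-- Position 1 is odd, hence permitted, so the left boundary is `turn`.
c-count : ∀ n → + c n ≡ count turn turn n ℤ.+ count turn straight n
c-count n = begin
  + c n ≡⟨ length-filterᵇ (allPV isOdd) (Perms n) ⟩
  total (indicator (allPV isOdd)) (Perms n)
    ≡⟨ total-perms _ (range n) ⟩
  permSum (indicator (allPV isOdd)) (range n)
    ≡⟨ permSum-cong eq (range n) ⟩
  permSum (λ σ → weight turn turn σ ℤ.+ weight turn straight σ) (range n)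
    ≡⟨ permSum-+ (weight turn turn) (weight turn straight) (range n) ⟩
  count turn turn n ℤ.+ count turn straight n ∎
  where
  open ≡-Reasoning
  eq : ∀ σ → indicator (allPV isOdd) σ ≡ weight turn turn σ ℤ.+ weight turn straight σ
  eq []           = refl
  eq (x ∷ [])     = refl
  eq (x ∷ y ∷ ys) = allPV-after isOdd-suc 2 x y ys refl

-- Position 1 is odd, hence forbidden, and nothing precedes it, so the left boundary is `straight`.
b-count : ∀ n → + b n ≡ count straight turn n ℤ.+ count straight straight n
b-count n = begin
  + b n ≡⟨ length-filterᵇ (allPV isEven) (Perms n) ⟩
  total (indicator (allPV isEven)) (Perms n)
    ≡⟨ total-perms _ (range n) ⟩
  permSum (indicator (allPV isEven)) (range n)
    ≡⟨ permSum-cong eq (range n) ⟩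
  permSum (λ σ → weight straight turn σ ℤ.+ weight straight straight σ) (range n)
    ≡⟨ permSum-+ (weight straight turn) (weight straight straight) (range n) ⟩
  count straight turn n ℤ.+ count straight straight n ∎
  where
  open ≡-Reasoning
  eq : ∀ σ → indicator (allPV isEven) σ ≡ weight straight turn σ ℤ.+ weight straight straight σ
  eq []           = refl
  eq (x ∷ [])     = refl
  eq (x ∷ y ∷ ys) = allPV-free isEven-suc 2 x y ys refl

-- The system of differential equations

module 𝓢 = CommutativeRing sequenceRing
open SequenceSolver using (solve; _:=_; _:+_; _:*_; :-_; con)
import Relation.Binary.Reasoning.Setoid 𝓢.setoid as SetoidReasoning

Vanishes : Sequence → ℕ → Set
Vanishes α n = ∀ k → k ℕ.≤ n → α k ≡ 0ℤ

*ˢ-vanishesʳ : ∀ n β {α} → Vanishes α n → (β *ˢ α) n ≡ 0ℤ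
*ˢ-vanishesʳ n β α≡0 = trans (*ˢ-cong-≤ n (λ _ _ → refl) α≡0) (𝓢.zeroʳ β n)

*ˢ-vanishesˡ : ∀ n β {α} → Vanishes α n → (α *ˢ β) n ≡ 0ℤ
*ˢ-vanishesˡ n β α≡0 = trans (*ˢ-cong-≤ n α≡0 (λ _ _ → refl)) (*ˢ-zeroˡ β n)

-- All other contributions contain an earlier, vanishing coefficient of `α`. This replaces division
-- by `denominator`: its constant term is not invertible but can be cancelled.
*ˢ-leading : ∀ n β α → (∀ k → k ℕ.< n → α k ≡ 0ℤ) → (β *ˢ α) n ≡ β 0 ℤ.* α n
*ˢ-leading zero    β α α≡0 = refl
*ˢ-leading (suc n) β α α≡0 = trans
  (cong₂ ℤ._+_ (*ˢ-vanishesʳ n (D β) (λ k k≤n → α≡0 k (s≤s k≤n)))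
               (*ˢ-leading n β (D α) (λ k k<n → α≡0 (suc k) (s≤s k<n))))
  (ℤₚ.+-identityˡ _)

-- Uniqueness of power series solutions of a system of differential equations.
vanishing : ∀ {I : Set} (χ : I → Sequence) → (∀ i → χ i 0 ≡ 0ℤ) →
            (∀ n → (∀ i → Vanishes (χ i) n) → ∀ i → D (χ i) n ≡ 0ℤ) → ∀ i n → χ i n ≡ 0ℤ
vanishing {I} χ base step i n = upTo n i n ℕₚ.≤-refl
  where
  upTo : ∀ n i → Vanishes (χ i) n
  upTo n       i zero    _         = base i
  upTo (suc n) i (suc k) (s≤s k≤n) = step k (λ j m m≤k → upTo n j m (ℕₚ.≤-trans m≤k k≤n)) i

≗-by-D : ∀ {α β} → α 0 ≡ β 0 → D α ≗ D β → α ≗ β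
≗-by-D p q zero    = p
≗-by-D p q (suc n) = q n

constant-*ˢ : ∀ z α → constant z *ˢ α ≗ λ n → z ℤ.* α n
constant-*ˢ z α zero    = refl
constant-*ˢ z α (suc n) = trans (cong₂ ℤ._+_ (*ˢ-zeroˡ α n) (constant-*ˢ z (D α) n)) (ℤₚ.+-identityˡ _)

D-scale : ∀ z α → D (constant z *ˢ α) ≗ constant z *ˢ D α
D-scale z α n = trans (cong₂ ℤ._+_ (*ˢ-zeroˡ α n) refl) (ℤₚ.+-identityˡ _)

-- Hyperbolic functions and the denominator

𝟙 𝟚 x coshˢ sinhˢ : Sequence
𝟙 = constant 1ℤ
𝟚 = constant (+ 2)

x 1 = 1ℤ
x _ = 0ℤ

-- cosh (√2 x) and its derivative √2 sinh (√2 x).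
coshˢ 0             = 1ℤ
coshˢ 1             = 0ℤ
coshˢ (suc (suc n)) = + 2 ℤ.* coshˢ n
sinhˢ = D coshˢ

D-x : D x ≗ 𝟙
D-x zero    = refl
D-x (suc n) = refl

D-x* : ∀ α → D (x *ˢ α) ≗ α +ˢ x *ˢ D α
D-x* α = 𝓢.+-cong (𝓢.trans (𝓢.*-cong D-x 𝓢.refl) (*ˢ-identityˡ α)) 𝓢.refl

D-sinhˢ : D sinhˢ ≗ 𝟚 *ˢ coshˢ
D-sinhˢ n = sym (constant-*ˢ (+ 2) coshˢ n)

sinh²≗2cosh²-2 : sinhˢ *ˢ sinhˢ ≗ 𝟚 *ˢ (coshˢ *ˢ coshˢ) +ˢ -ˢ 𝟚
sinh²≗2cosh²-2 = ≗-by-D refl (begin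
  D sinhˢ *ˢ sinhˢ +ˢ sinhˢ *ˢ D sinhˢ
    ≈⟨ 𝓢.+-cong (𝓢.*-cong D-sinhˢ 𝓢.refl) (𝓢.*-cong (𝓢.refl {sinhˢ}) D-sinhˢ) ⟩
  (𝟚 *ˢ coshˢ) *ˢ sinhˢ +ˢ sinhˢ *ˢ (𝟚 *ˢ coshˢ)
    ≈⟨ solve 2 (λ c s → con (+ 2) :* c :* s :+ s :* (con (+ 2) :* c) := con (+ 2) :* (s :* c :+ c :* s)) 𝓢.refl coshˢ sinhˢ ⟩
  𝟚 *ˢ (sinhˢ *ˢ coshˢ +ˢ coshˢ *ˢ sinhˢ)
    ≈⟨ D-scale (+ 2) (coshˢ *ˢ coshˢ) ⟨
  D (𝟚 *ˢ (coshˢ *ˢ coshˢ))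
    ≈⟨ (λ n → ℤₚ.+-identityʳ _) ⟨
  D (𝟚 *ˢ (coshˢ *ˢ coshˢ) +ˢ -ˢ 𝟚) ∎)
  where open SetoidReasoning

numerator denominator : Sequence
numerator   = 𝟚 +ˢ 𝟚 *ˢ coshˢ +ˢ x *ˢ sinhˢ
denominator = 𝟚 +ˢ 𝟚 *ˢ coshˢ +ˢ -ˢ (x *ˢ sinhˢ)

D-x*sinhˢ : D (x *ˢ sinhˢ) ≗ sinhˢ +ˢ x *ˢ (𝟚 *ˢ coshˢ)
D-x*sinhˢ = 𝓢.trans (D-x* sinhˢ) (𝓢.+-cong (𝓢.refl {sinhˢ}) (𝓢.*-cong (𝓢.refl {x}) D-sinhˢ))

slope : Sequence
slope = sinhˢ +ˢ -ˢ (𝟚 *ˢ (x *ˢ coshˢ))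

D-2+2coshˢ : D (𝟚 +ˢ 𝟚 *ˢ coshˢ) ≗ 𝟚 *ˢ sinhˢ
D-2+2coshˢ = 𝓢.trans (λ _ → ℤₚ.+-identityˡ _) (D-scale (+ 2) coshˢ)

D-denominator : D denominator ≗ slope
D-denominator = 𝓢.trans (𝓢.+-cong D-2+2coshˢ (𝓢.-‿cong D-x*sinhˢ))
  (solve 3 (λ x c s → con (+ 2) :* s :+ :- (s :+ x :* (con (+ 2) :* c)) := s :+ :- (con (+ 2) :* (x :* c))) 𝓢.refl x coshˢ sinhˢ)

D-slope : D slope ≗ -ˢ (𝟚 *ˢ (x *ˢ sinhˢ))
D-slope = 𝓢.trans
  (𝓢.+-cong D-sinhˢ (𝓢.-‿cong (𝓢.trans (D-scale (+ 2) (x *ˢ coshˢ)) (𝓢.*-cong (𝓢.refl {𝟚}) (D-x* coshˢ)))))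
  (solve 3 (λ x c s → con (+ 2) :* c :+ :- (con (+ 2) :* (c :+ x :* s)) := :- (con (+ 2) :* (x :* s))) 𝓢.refl x coshˢ sinhˢ)

-- Reversal of permutations would exchange the boundaries. The symmetry is instead read off the
-- recurrence: swapping `s` and `t` exchanges the two end terms and fixes the other two, up to
-- commutativity and the induction hypothesis.
count-sym : ∀ s t → count s t ≗ count t s
count-sym s t n = upTo n s t n ℕₚ.≤-refl
  where
  weight-sym : ∀ s t → count s t 0 ≡ count t s 0
  weight-sym turn     turn     = refl
  weight-sym turn     straight = refl
  weight-sym turn     floor    = refl
  weight-sym straight turn     = refl
  weight-sym straight straight = refl
  weight-sym straight floor    = refl
  weight-sym floor    turn     = refl
  weight-sym floor    straight = refl
  weight-sym floor    floor    = refl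

  κ-sym : ∀ s t → κ s t ≡ κ t s
  κ-sym turn     turn     = refl
  κ-sym turn     straight = refl
  κ-sym turn     floor    = refl
  κ-sym straight turn     = refl
  κ-sym straight straight = refl
  κ-sym straight floor    = refl
  κ-sym floor    turn     = refl
  κ-sym floor    straight = refl
  κ-sym floor    floor    = refl

  upTo : ∀ n s t k → k ℕ.≤ n → count s t k ≡ count t s k
  upTo n       s t zero    _         = weight-sym s t
  upTo (suc n) s t (suc k) (s≤s k≤n) = begin
    count s t (suc k)
      ≡⟨ D-count s t k ⟩
    countDerivative s t k
      ≡⟨ interchange ((count s floor *ˢ count floor t) k) _ _ _ ⟩
    ((count s floor *ˢ count floor t) k ℤ.+ (count s turn *ˢ constant (ν t)) k) ℤ.+
    ((constant (ν s) *ˢ count turn t) k ℤ.+ (constant (ℤ.- κ s t) *ˢ 𝟙) k)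
      ≡⟨ cong₂ ℤ._+_
           (cong₂ ℤ._+_ (flip (IH s floor) (IH floor t)) (flip (IH s turn) (λ _ _ → refl)))
           (cong₂ ℤ._+_ (flip {constant (ν s)} (λ _ _ → refl) (IH turn t)) (cong (λ z → (constant (ℤ.- z) *ˢ 𝟙) k) (κ-sym s t))) ⟩
    countDerivative t s k
      ≡⟨ D-count t s k ⟨
    count t s (suc k) ∎
    where
    open ≡-Reasoning
    IH : ∀ s t j → j ℕ.≤ k → count s t j ≡ count t s j
    IH s t j j≤k = upTo n s t j (ℕₚ.≤-trans j≤k k≤n)
    flip : ∀ {α α′ β β′} → (∀ j → j ℕ.≤ k → α j ≡ α′ j) → (∀ j → j ℕ.≤ k → β j ≡ β′ j) →
           (α *ˢ β) k ≡ (β′ *ˢ α′) k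
    flip p q = trans (*ˢ-cong-≤ k p q) (*ˢ-comm _ _ k)

-- By count-sym these six cover the nine pairs of boundaries.
F R M E H O : Sequence
F = count turn turn
R = count turn floor
M = count floor floor
E = count turn straight
H = count floor straight
O = count straight straight

D-F : D F ≗ R *ˢ R
D-F = begin
  D F ≈⟨ D-count turn turn ⟩
  (R *ˢ count floor turn +ˢ constant 0ℤ *ˢ F) +ˢ (F *ˢ constant 0ℤ +ˢ constant 0ℤ *ˢ 𝟙)
    ≈⟨ 𝓢.+-cong (𝓢.+-cong (𝓢.*-cong (𝓢.refl {R}) (count-sym floor turn)) 𝓢.refl) 𝓢.refl ⟩
  (R *ˢ R +ˢ constant 0ℤ *ˢ F) +ˢ (F *ˢ constant 0ℤ +ˢ constant 0ℤ *ˢ 𝟙)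
    ≈⟨ solve 2 (λ F R → (R :* R :+ con 0ℤ :* F) :+ (F :* con 0ℤ :+ con 0ℤ :* con 1ℤ) := R :* R) 𝓢.refl F R ⟩
  R *ˢ R ∎
  where open SetoidReasoning

D-R : D R ≗ F +ˢ R *ˢ M
D-R = 𝓢.trans (D-count turn floor)
  (solve 3 (λ F R M → (R :* M :+ con 0ℤ :* R) :+ (F :* con 1ℤ :+ con 0ℤ :* con 1ℤ) := F :+ R :* M) 𝓢.refl F R M)

D-M : D M ≗ M *ˢ M +ˢ 𝟚 *ˢ R +ˢ -ˢ 𝟚
D-M = begin
  D M ≈⟨ D-count floor floor ⟩
  (M *ˢ M +ˢ 𝟙 *ˢ R) +ˢ (count floor turn *ˢ 𝟙 +ˢ constant (ℤ.- + 2) *ˢ 𝟙)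
    ≈⟨ 𝓢.+-cong (𝓢.refl {M *ˢ M +ˢ 𝟙 *ˢ R}) (𝓢.+-cong (𝓢.*-cong (count-sym floor turn) (𝓢.refl {𝟙})) 𝓢.refl) ⟩
  (M *ˢ M +ˢ 𝟙 *ˢ R) +ˢ (R *ˢ 𝟙 +ˢ constant (ℤ.- + 2) *ˢ 𝟙)
    ≈⟨ solve 2 (λ R M → (M :* M :+ con 1ℤ :* R) :+ (R :* con 1ℤ :+ con (ℤ.- + 2) :* con 1ℤ) :=
                        M :* M :+ con (+ 2) :* R :+ :- con (+ 2)) 𝓢.refl R M ⟩
  M *ˢ M +ˢ 𝟚 *ˢ R +ˢ -ˢ 𝟚 ∎
  where open SetoidReasoning

D-E : D E ≗ F +ˢ R *ˢ H
D-E = 𝓢.trans (D-count turn straight)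
  (solve 4 (λ F R E H → (R :* H :+ con 0ℤ :* E) :+ (F :* con 1ℤ :+ con 0ℤ :* con 1ℤ) := F :+ R :* H) 𝓢.refl F R E H)

D-H : D H ≗ M *ˢ H +ˢ E +ˢ R +ˢ -ˢ 𝟙
D-H = begin
  D H ≈⟨ D-count floor straight ⟩
  (M *ˢ H +ˢ 𝟙 *ˢ E) +ˢ (count floor turn *ˢ 𝟙 +ˢ constant -1ℤ *ˢ 𝟙)
    ≈⟨ 𝓢.+-cong (𝓢.refl {M *ˢ H +ˢ 𝟙 *ˢ E}) (𝓢.+-cong (𝓢.*-cong (count-sym floor turn) (𝓢.refl {𝟙})) 𝓢.refl) ⟩
  (M *ˢ H +ˢ 𝟙 *ˢ E) +ˢ (R *ˢ 𝟙 +ˢ constant -1ℤ *ˢ 𝟙)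
    ≈⟨ solve 4 (λ R M E H → (M :* H :+ con 1ℤ :* E) :+ (R :* con 1ℤ :+ con -1ℤ :* con 1ℤ) :=
                            M :* H :+ E :+ R :+ :- con 1ℤ) 𝓢.refl R M E H ⟩
  M *ˢ H +ˢ E +ˢ R +ˢ -ˢ 𝟙 ∎
  where open SetoidReasoning

D-O : D O ≗ H *ˢ H +ˢ 𝟚 *ˢ E +ˢ -ˢ 𝟙
D-O = begin
  D O ≈⟨ D-count straight straight ⟩
  (count straight floor *ˢ H +ˢ 𝟙 *ˢ E) +ˢ (count straight turn *ˢ 𝟙 +ˢ constant -1ℤ *ˢ 𝟙)
    ≈⟨ 𝓢.+-cong (𝓢.+-cong (𝓢.*-cong (count-sym straight floor) (𝓢.refl {H})) (𝓢.refl {𝟙 *ˢ E}))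
                (𝓢.+-cong (𝓢.*-cong (count-sym straight turn) (𝓢.refl {𝟙})) 𝓢.refl) ⟩
  (H *ˢ H +ˢ 𝟙 *ˢ E) +ˢ (E *ˢ 𝟙 +ˢ constant -1ℤ *ˢ 𝟙)
    ≈⟨ solve 2 (λ E H → (H :* H :+ con 1ℤ :* E) :+ (E :* con 1ℤ :+ con -1ℤ :* con 1ℤ) :=
                        H :* H :+ con (+ 2) :* E :+ :- con 1ℤ) 𝓢.refl E H ⟩
  H *ˢ H +ˢ 𝟚 *ˢ E +ˢ -ˢ 𝟙 ∎
  where open SetoidReasoning

-- Verification of the closed forms

difference-vanishes : ∀ {α β} → α +ˢ -ˢ β ≗ (λ _ → 0ℤ) → α ≗ β
difference-vanishes p n = ℤₚ.i-j≡0⇒i≡j _ _ (p n)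

-- The claimed closed forms of F, R and M, multiplied by the denominator.
residual : Fin 3 → Sequence
residual 0F = denominator *ˢ F +ˢ -ˢ (𝟚 *ˢ sinhˢ)
residual 1F = denominator *ˢ R +ˢ -ˢ (𝟚 +ˢ 𝟚 *ˢ coshˢ)
residual 2F = denominator *ˢ M +ˢ slope

-- The term R² is quadratic, so a second factor `denominator` is needed to form (ΔR)² - (2 + 2c)²,
-- which contains `residual 1F` as a factor. What is left over is a multiple of s² - (2c² - 2).
denominator*D-residual₀ : denominator *ˢ D (residual 0F) ≗
  slope *ˢ residual 0F +ˢ residual 1F *ˢ (denominator *ˢ R +ˢ (𝟚 +ˢ 𝟚 *ˢ coshˢ))
denominator*D-residual₀ = begin
  denominator *ˢ ((D denominator *ˢ F +ˢ denominator *ˢ D F) +ˢ -ˢ D (𝟚 *ˢ sinhˢ))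
    ≈⟨ 𝓢.*-cong (𝓢.refl {denominator}) (𝓢.+-cong
         (𝓢.+-cong (𝓢.*-cong D-denominator (𝓢.refl {F})) (𝓢.*-cong (𝓢.refl {denominator}) D-F))
         (𝓢.-‿cong (𝓢.trans (D-scale (+ 2) sinhˢ) (𝓢.*-cong (𝓢.refl {𝟚}) D-sinhˢ)))) ⟩
  denominator *ˢ ((slope *ˢ F +ˢ denominator *ˢ (R *ˢ R)) +ˢ -ˢ (𝟚 *ˢ (𝟚 *ˢ coshˢ)))
    ≈⟨ solve 5 (λ x c s F R →
         let d = con (+ 2) :+ con (+ 2) :* c :+ :- (x :* s)
             k = s :+ :- (con (+ 2) :* (x :* c))
             n = con (+ 2) :+ con (+ 2) :* c
         in d :* ((k :* F :+ d :* (R :* R)) :+ :- (con (+ 2) :* (con (+ 2) :* c))) :=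
            k :* (d :* F :+ :- (con (+ 2) :* s)) :+ (d :* R :+ :- n) :* (d :* R :+ n) :+
            con (+ 2) :* (s :* s :+ :- (con (+ 2) :* (c :* c) :+ :- con (+ 2))))
         𝓢.refl x coshˢ sinhˢ F R ⟩
  rest +ˢ 𝟚 *ˢ (sinhˢ *ˢ sinhˢ +ˢ -ˢ square)
    ≈⟨ 𝓢.+-cong (𝓢.refl {rest}) (𝓢.*-cong (𝓢.refl {𝟚}) (𝓢.+-cong sinh²≗2cosh²-2 (𝓢.refl { -ˢ square}))) ⟩
  rest +ˢ 𝟚 *ˢ (square +ˢ -ˢ square)
    ≈⟨ solve 2 (λ r q → r :+ con (+ 2) :* (q :+ :- q) := r) 𝓢.refl rest square ⟩
  rest ∎
  where
  open SetoidReasoning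
  rest square : Sequence
  rest = slope *ˢ residual 0F +ˢ residual 1F *ˢ (denominator *ˢ R +ˢ (𝟚 +ˢ 𝟚 *ˢ coshˢ))
  square = 𝟚 *ˢ (coshˢ *ˢ coshˢ) +ˢ -ˢ 𝟚

D-residual₁ : D (residual 1F) ≗ R *ˢ residual 2F +ˢ residual 0F
D-residual₁ = begin
  (D denominator *ˢ R +ˢ denominator *ˢ D R) +ˢ -ˢ D (𝟚 +ˢ 𝟚 *ˢ coshˢ)
    ≈⟨ 𝓢.+-cong
         (𝓢.+-cong (𝓢.*-cong D-denominator (𝓢.refl {R})) (𝓢.*-cong (𝓢.refl {denominator}) D-R))
         (𝓢.-‿cong D-2+2coshˢ) ⟩
  (slope *ˢ R +ˢ denominator *ˢ (F +ˢ R *ˢ M)) +ˢ -ˢ (𝟚 *ˢ sinhˢ)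
    ≈⟨ solve 6 (λ d k s F R M → (k :* R :+ d :* (F :+ R :* M)) :+ :- (con (+ 2) :* s) :=
                                R :* (d :* M :+ k) :+ (d :* F :+ :- (con (+ 2) :* s)))
         𝓢.refl denominator slope sinhˢ F R M ⟩
  R *ˢ residual 2F +ˢ residual 0F ∎
  where open SetoidReasoning

D-residual₂ : D (residual 2F) ≗ M *ˢ residual 2F +ˢ 𝟚 *ˢ residual 1F
D-residual₂ = begin
  (D denominator *ˢ M +ˢ denominator *ˢ D M) +ˢ D slope
    ≈⟨ 𝓢.+-cong
         (𝓢.+-cong (𝓢.*-cong D-denominator (𝓢.refl {M})) (𝓢.*-cong (𝓢.refl {denominator}) D-M)) D-slope ⟩
  (slope *ˢ M +ˢ denominator *ˢ (M *ˢ M +ˢ 𝟚 *ˢ R +ˢ -ˢ 𝟚)) +ˢ -ˢ (𝟚 *ˢ (x *ˢ sinhˢ))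
    ≈⟨ solve 5 (λ x c s R M →
         let d = con (+ 2) :+ con (+ 2) :* c :+ :- (x :* s)
             k = s :+ :- (con (+ 2) :* (x :* c))
         in (k :* M :+ d :* (M :* M :+ con (+ 2) :* R :+ :- con (+ 2))) :+ :- (con (+ 2) :* (x :* s)) :=
            M :* (d :* M :+ k) :+ con (+ 2) :* (d :* R :+ :- (con (+ 2) :+ con (+ 2) :* c)))
         𝓢.refl x coshˢ sinhˢ R M ⟩
  M *ˢ residual 2F +ˢ 𝟚 *ˢ residual 1F ∎
  where open SetoidReasoning

residual-vanishes : ∀ i → residual i ≗ λ _ → 0ℤ
residual-vanishes = vanishing residual base induct
  where
  base : ∀ i → residual i 0 ≡ 0ℤ
  base 0F = refl
  base 1F = refl
  base 2F = refl
  induct : ∀ n → (∀ i → Vanishes (residual i) n) → ∀ i → D (residual i) n ≡ 0ℤ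
  -- The constant term of `denominator` is 2 + 2·1 - 0 = 4. The lower coefficients of the derivative
  -- vanish by hypothesis, so only this multiple of the `n`-th one survives.
  induct n res≡0 0F = ℤₚ.*-cancelˡ-≡ (+ 4) _ _ (trans
    (sym (*ˢ-leading n denominator (D (residual 0F)) (λ k k<n → res≡0 0F (suc k) k<n)))
    (trans (denominator*D-residual₀ n) (cong₂ ℤ._+_
      (*ˢ-vanishesʳ n slope (res≡0 0F)) (*ˢ-vanishesˡ n (denominator *ˢ R +ˢ (𝟚 +ˢ 𝟚 *ˢ coshˢ)) (res≡0 1F)))))
  induct n res≡0 1F = trans (D-residual₁ n) (cong₂ ℤ._+_ (*ˢ-vanishesʳ n R (res≡0 2F)) (res≡0 0F n ℕₚ.≤-refl))
  induct n res≡0 2F = trans (D-residual₂ n) (cong₂ ℤ._+_ (*ˢ-vanishesʳ n M (res≡0 2F)) (*ˢ-vanishesʳ n 𝟚 (res≡0 1F)))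

denominator*F : denominator *ˢ F ≗ 𝟚 *ˢ sinhˢ
denominator*F = difference-vanishes (residual-vanishes 0F)

-- These relations between counts follow from the differential equations alone, before any closed
-- form enters, so no factor `denominator` is required.
residualᴱᴴ : Fin 2 → Sequence
residualᴱᴴ 0F = E +ˢ -ˢ (𝟙 +ˢ x *ˢ F)
residualᴱᴴ 1F = H +ˢ -ˢ (x *ˢ R)

D-residualᴱ : D (residualᴱᴴ 0F) ≗ R *ˢ residualᴱᴴ 1F
D-residualᴱ = begin
  D E +ˢ -ˢ D (𝟙 +ˢ x *ˢ F)
    ≈⟨ 𝓢.+-cong D-E (𝓢.-‿cong (𝓢.trans (λ _ → ℤₚ.+-identityˡ _)
         (𝓢.trans (D-x* F) (𝓢.+-cong (𝓢.refl {F}) (𝓢.*-cong (𝓢.refl {x}) D-F))))) ⟩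
  (F +ˢ R *ˢ H) +ˢ -ˢ (F +ˢ x *ˢ (R *ˢ R))
    ≈⟨ solve 4 (λ x F R H → (F :+ R :* H) :+ :- (F :+ x :* (R :* R)) := R :* (H :+ :- (x :* R))) 𝓢.refl x F R H ⟩
  R *ˢ residualᴱᴴ 1F ∎
  where open SetoidReasoning

D-residualᴴ : D (residualᴱᴴ 1F) ≗ M *ˢ residualᴱᴴ 1F +ˢ residualᴱᴴ 0F
D-residualᴴ = begin
  D H +ˢ -ˢ D (x *ˢ R)
    ≈⟨ 𝓢.+-cong D-H (𝓢.-‿cong (𝓢.trans (D-x* R) (𝓢.+-cong (𝓢.refl {R}) (𝓢.*-cong (𝓢.refl {x}) D-R)))) ⟩
  (M *ˢ H +ˢ E +ˢ R +ˢ -ˢ 𝟙) +ˢ -ˢ (R +ˢ x *ˢ (F +ˢ R *ˢ M))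
    ≈⟨ solve 6 (λ x F R M E H →
         (M :* H :+ E :+ R :+ :- con 1ℤ) :+ :- (R :+ x :* (F :+ R :* M)) :=
         M :* (H :+ :- (x :* R)) :+ (E :+ :- (con 1ℤ :+ x :* F))) 𝓢.refl x F R M E H ⟩
  M *ˢ residualᴱᴴ 1F +ˢ residualᴱᴴ 0F ∎
  where open SetoidReasoning

residualᴱᴴ-vanishes : ∀ i → residualᴱᴴ i ≗ λ _ → 0ℤ
residualᴱᴴ-vanishes = vanishing residualᴱᴴ base induct
  where
  base : ∀ i → residualᴱᴴ i 0 ≡ 0ℤ
  base 0F = refl
  base 1F = refl
  induct : ∀ n → (∀ i → Vanishes (residualᴱᴴ i) n) → ∀ i → D (residualᴱᴴ i) n ≡ 0ℤ
  induct n res≡0 0F = trans (D-residualᴱ n) (*ˢ-vanishesʳ n R (res≡0 1F))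
  induct n res≡0 1F = trans (D-residualᴴ n) (cong₂ ℤ._+_ (*ˢ-vanishesʳ n M (res≡0 1F)) (res≡0 0F n ℕₚ.≤-refl))

E≗1+xF : E ≗ 𝟙 +ˢ x *ˢ F
E≗1+xF = difference-vanishes (residualᴱᴴ-vanishes 0F)

H≗xR : H ≗ x *ˢ R
H≗xR = difference-vanishes (residualᴱᴴ-vanishes 1F)

-- Of the two copies of `E` in `D O`, one is kept and the other expanded as 1 + xF, so that the
-- remainder becomes x times `D E`. This relation is the source of the factor 1 + x.
O≗xE : O ≗ x *ˢ E
O≗xE = ≗-by-D refl (begin
  D O ≈⟨ D-O ⟩
  H *ˢ H +ˢ 𝟚 *ˢ E +ˢ -ˢ 𝟙
    ≈⟨ solve 2 (λ E H → H :* H :+ con (+ 2) :* E :+ :- con 1ℤ := E :+ (E :+ :- con 1ℤ :+ H :* H)) 𝓢.refl E H ⟩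
  E +ˢ (E +ˢ -ˢ 𝟙 +ˢ H *ˢ H)
    ≈⟨ 𝓢.+-cong (𝓢.refl {E}) (𝓢.+-cong (𝓢.+-cong E≗1+xF (𝓢.refl { -ˢ 𝟙})) (𝓢.*-cong H≗xR (𝓢.refl {H}))) ⟩
  E +ˢ (𝟙 +ˢ x *ˢ F +ˢ -ˢ 𝟙 +ˢ x *ˢ R *ˢ H)
    ≈⟨ solve 5 (λ x F R E H → E :+ (con 1ℤ :+ x :* F :+ :- con 1ℤ :+ x :* R :* H) := E :+ x :* (F :+ R :* H)) 𝓢.refl x F R E H ⟩
  E +ˢ x *ˢ (F +ˢ R *ˢ H)
    ≈⟨ 𝓢.+-cong (𝓢.refl {E}) (𝓢.*-cong (𝓢.refl {x}) D-E) ⟨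
  E +ˢ x *ˢ D E
    ≈⟨ D-x* E ⟨
  D (x *ˢ E) ∎)
  where open SetoidReasoning

E*denominator : E *ˢ denominator ≗ numerator
E*denominator = begin
  E *ˢ denominator
    ≈⟨ 𝓢.*-cong E≗1+xF (𝓢.refl {denominator}) ⟩
  (𝟙 +ˢ x *ˢ F) *ˢ denominator
    ≈⟨ solve 3 (λ x F d → (con 1ℤ :+ x :* F) :* d := d :+ x :* (d :* F)) 𝓢.refl x F denominator ⟩
  denominator +ˢ x *ˢ (denominator *ˢ F)
    ≈⟨ 𝓢.+-cong (𝓢.refl {denominator}) (𝓢.*-cong (𝓢.refl {x}) denominator*F) ⟩
  denominator +ˢ x *ˢ (𝟚 *ˢ sinhˢ)
    ≈⟨ solve 3 (λ x c s → (con (+ 2) :+ con (+ 2) :* c :+ :- (x :* s)) :+ x :* (con (+ 2) :* s) :=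
                          con (+ 2) :+ con (+ 2) :* c :+ x :* s) 𝓢.refl x coshˢ sinhˢ ⟩
  numerator ∎
  where open SetoidReasoning

oddTurns*denominator : (F +ˢ E) *ˢ denominator ≗ 𝟚 +ˢ 𝟚 *ˢ coshˢ +ˢ (𝟚 +ˢ x) *ˢ sinhˢ
oddTurns*denominator = begin
  (F +ˢ E) *ˢ denominator
    ≈⟨ solve 3 (λ F E d → (F :+ E) :* d := d :* F :+ E :* d) 𝓢.refl F E denominator ⟩
  denominator *ˢ F +ˢ E *ˢ denominator
    ≈⟨ 𝓢.+-cong denominator*F E*denominator ⟩
  𝟚 *ˢ sinhˢ +ˢ numerator
    ≈⟨ solve 3 (λ x c s → con (+ 2) :* s :+ (con (+ 2) :+ con (+ 2) :* c :+ x :* s) :=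
                          con (+ 2) :+ con (+ 2) :* c :+ (con (+ 2) :+ x) :* s) 𝓢.refl x coshˢ sinhˢ ⟩
  𝟚 +ˢ 𝟚 *ˢ coshˢ +ˢ (𝟚 +ˢ x) *ˢ sinhˢ ∎
  where open SetoidReasoning

evenTurns*denominator : (E +ˢ O) *ˢ denominator ≗ (𝟙 +ˢ x) *ˢ numerator
evenTurns*denominator = begin
  (E +ˢ O) *ˢ denominator
    ≈⟨ 𝓢.*-cong (𝓢.+-cong (𝓢.refl {E}) O≗xE) (𝓢.refl {denominator}) ⟩
  (E +ˢ x *ˢ E) *ˢ denominator
    ≈⟨ solve 3 (λ x E d → (E :+ x :* E) :* d := (con 1ℤ :+ x) :* (E :* d)) 𝓢.refl x E denominator ⟩
  (𝟙 +ˢ x) *ˢ (E *ˢ denominator)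
    ≈⟨ 𝓢.*-cong (𝓢.refl {𝟙 +ˢ x}) E*denominator ⟩
  (𝟙 +ˢ x) *ˢ numerator ∎
  where open SetoidReasoning

-- The series of the statement as integer sequences

two-represents : two represents 𝟚
coefficients two-represents zero = refl
coefficients two-represents (suc n) = sym (ℚₚ.*-zeroˡ (inv! (suc n)))

one-represents : const 1ℚ represents 𝟙
coefficients one-represents zero = refl
coefficients one-represents (suc n) = sym (ℚₚ.*-zeroˡ (inv! (suc n)))

X-represents : X represents x
coefficients X-represents zero = refl
coefficients X-represents (suc zero) = refl
coefficients X-represents (suc (suc n)) = sym (ℚₚ.*-zeroˡ (inv! (suc (suc n))))

2+n/2 : ∀ n → suc (suc n) ℕ./ 2 ≡ suc (n ℕ./ 2)
2+n/2 n = ℕDivMod.m/n≡1+[m∸n]/n {suc (suc n)} {2} (s≤s (s≤s z≤n))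

coshˢ-closed : ∀ n → coshˢ n ≡ (if isEven n then + (2 ℕ.^ (n ℕ./ 2)) else 0ℤ)
coshˢ-closed 0             = refl
coshˢ-closed 1             = refl
coshˢ-closed (suc (suc n)) rewrite coshˢ-closed n | 2+n/2 n with isEven n
... | true  = sym (ℤₚ.pos-* 2 (2 ℕ.^ (n ℕ./ 2)))
... | false = refl

sinhˢ-closed : ∀ n → sinhˢ n ≡ (if isOdd n then + (2 ℕ.^ suc (n ℕ./ 2)) else 0ℤ)
sinhˢ-closed 0             = refl
sinhˢ-closed 1             = refl
sinhˢ-closed (suc (suc n)) rewrite sinhˢ-closed n | 2+n/2 n with isEven n
... | true  = refl
... | false = sym (ℤₚ.pos-* 2 (2 ℕ.^ suc (n ℕ./ 2)))

coshR2-represents : coshR2 represents coshˢ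
coefficients coshR2-represents n rewrite coshˢ-closed n with isEven n
... | true  = refl
... | false = sym (ℚₚ.*-zeroˡ (inv! n))

r2sinhR2-represents : r2sinhR2 represents sinhˢ
coefficients r2sinhR2-represents n rewrite sinhˢ-closed n with isOdd n
... | true  = refl
... | false = sym (ℚₚ.*-zeroˡ (inv! n))

Den-represents : Den represents denominator
Den-represents = represents-⊖
  (represents-⊕ two-represents (represents-⊛ two-represents coshR2-represents))
  (represents-⊛ X-represents r2sinhR2-represents)

NumB-represents : NumB represents numerator
NumB-represents = represents-⊕
  (represents-⊕ two-represents (represents-⊛ two-represents coshR2-represents))
  (represents-⊛ X-represents r2sinhR2-represents)

NumC-represents : NumC represents 𝟚 +ˢ 𝟚 *ˢ coshˢ +ˢ (𝟚 +ˢ x) *ˢ sinhˢ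
NumC-represents = represents-⊕
  (represents-⊕ two-represents (represents-⊛ two-represents coshR2-represents))
  (represents-⊛ (represents-⊕ two-represents X-represents) r2sinhR2-represents)

theorem4 : ((n : ℕ) → (egf b ⊛ Den) n ≡ (onePlusX ⊛ NumB) n)
    × ((n : ℕ) → (egf c ⊛ Den) n ≡ NumC n)
theorem4 =
  represents-≗ (represents-⊛ (egf-represents b) Den-represents)
    (𝓢.trans (𝓢.*-cong b≗E+O (𝓢.refl {denominator})) evenTurns*denominator)
    (represents-⊛ (represents-⊕ one-represents X-represents) NumB-represents) ,
  represents-≗ (represents-⊛ (egf-represents c) Den-represents)
    (𝓢.trans (𝓢.*-cong c-count (𝓢.refl {denominator})) oddTurns*denominator)
    NumC-represents
  where
  b≗E+O : (λ n → + b n) ≗ E +ˢ O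
  b≗E+O = 𝓢.trans b-count (𝓢.+-cong (count-sym straight turn) (𝓢.refl {O}))
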